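{- Let $m>1$ be an integer and let $k\ge 1$, $\epsilon>0$ be real numbers. Then there exists a path-connected topological design problem with $M=m$ and $K\le k+\epsilon$ that admits no design of size $(m-1)(k+1)$ or less.
   Context: A topological design problem is a triple $(X,\mu,W)$ where $X$ is a topological space with its Borel $\sigma$-algebra, $\mu$ is a positive measure on it with $\mu(X)=1$, and $W$ is a finite-dimensional real vector space of bounded continuous functions $X\to\mathbb{R}$. It is path-connected if $X$ is path-connected. A design of size $N$ ($N\ge 1$ an integer) is a list of $N$ points $p_1,\dots,p_N\in X$ (not necessarily distinct) with $\int_X f\,d\mu=\frac1N\sum_{i=1}^N f(p_i)$ for all $f\in W$. Let $V$ be the space of all $f\in W+\langle 1\rangle$ (where $1$ is the constant function) with $\int_X f\,d\mu=0$, let $M=\dim V$, and let $$K=\sup_{f\in V\setminus\{0\}}\frac{\sup(f)}{|\inf(f)|}\in[0,\infty],$$ where a ratio with positive numerator and zero denominator is $+\infty$. -}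

module Defs where

open import Level using (Level; 0ℓ) renaming (suc to lsuc; _⊔_ to _⊔ˡ_)
open import Algebra.Bundles using (CommutativeRing)
import Algebra.Properties.Ring as RingProperties
import Algebra.Properties.Monoid.Sum as MonoidSum
import Algebra.Properties.Monoid.Mult as MonoidMult
import Algebra.Construct.NaturalChoice.Max as Max
open import Data.Fin.Base using (Fin; toℕ)
open import Data.Nat.Base as ℕ using (ℕ)
open import Data.Product.Base using (Σ; ∃; ∃₂; ∃-syntax; _×_; _,_; proj₁; proj₂)
open import Data.Sum.Base using (_⊎_; inj₁; inj₂)
open import Function.Base using (flip)
open import Function.Bundles using (Func)
import Function.Construct.Identity as Identity
open import Relation.Binary.Bundles using (Setoid; TotalOrder)
open import Relation.Binary.Core using (Rel)
open import Relation.Binary.Structures using (IsTotalOrder)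
open import Relation.Binary.PropositionalEquality.Core using (_≡_; _≢_)
import Relation.Binary.Construct.Add.Supremum.NonStrict as AddSupremum
import Relation.Binary.Construct.NonStrictToStrict as ToStrict
import Relation.Binary.Construct.On as On
open import Relation.Nullary.Construct.Add.Supremum using (_⁺; [_]; ⊤⁺)
open import Relation.Nullary.Negation.Core using (¬_)
open import Relation.Unary
  using (Pred; U; Satisfiable; _≐_; _∩_; ∁; ⋃; _⊥_; _⊢_; _∈_)

private
  variable
    a r p : Level

IsLub : {A : Set a} → Rel A r → Pred A p → A → Set (a ⊔ˡ r ⊔ˡ p)
IsLub _≤_ S s = (∀ x → S x → x ≤ s) × (∀ u → (∀ x → S x → x ≤ u) → s ≤ u)

IsGlb : {A : Set a} → Rel A r → Pred A p → A → Set (a ⊔ˡ r ⊔ˡ p)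
IsGlb _≤_ = IsLub (flip _≤_)

-- Classically there is exactly one complete ordered field up to
-- isomorphism, and it is ℝ.  The inverse is total, as is usual in
-- classical formalizations; its value at 0# is irrelevant.
record CompleteOrderedField : Set₁ where
  infix  8 _⁻¹
  infix  4 _≤_
  field
    commutativeRing : CommutativeRing 0ℓ 0ℓ
  open CommutativeRing commutativeRing public
  field
    _⁻¹          : Carrier → Carrier
    ⁻¹-cong      : ∀ {x y} → x ≈ y → x ⁻¹ ≈ y ⁻¹
    ⁻¹-inverse   : ∀ {x} → ¬ x ≈ 0# → x * x ⁻¹ ≈ 1#
    0≉1          : ¬ 0# ≈ 1#
    _≤_          : Rel Carrier 0ℓ
    isTotalOrder : IsTotalOrder _≈_ _≤_
    +-mono-≤     : ∀ {x y} z → x ≤ y → x + z ≤ y + z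
    *-nonneg     : ∀ {x y} → 0# ≤ x → 0# ≤ y → 0# ≤ x * y
    complete     : (S : Pred Carrier 0ℓ) → Satisfiable S →
                   (∃[ b ] (∀ x → S x → x ≤ b)) → ∃[ s ] IsLub _≤_ S s

  totalOrder : TotalOrder 0ℓ 0ℓ 0ℓ
  totalOrder = record { isTotalOrder = isTotalOrder }

  open IsTotalOrder isTotalOrder public
    using (antisym; total; ≤-respʳ-≈; ≤-respˡ-≈)
    renaming (refl to ≤-refl; reflexive to ≤-reflexive; trans to ≤-trans)
  open Max totalOrder public using (_⊔_; ⊔-cong)
  open ToStrict _≈_ _≤_ public using (_<_)
  open MonoidSum +-monoid public using (sum)
  open MonoidMult +-monoid public using () renaming (_×_ to _·_)

  fromℕ : ℕ → Carrier
  fromℕ n = n · 1#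

  ∣_∣ : Carrier → Carrier
  ∣ x ∣ = x ⊔ (- x)

  0≤1 : 0# ≤ 1#
  0≤1 with total 0# 1#
  ... | inj₁ 0≤1 = 0≤1
  ... | inj₂ 1≤0 = ≤-respʳ-≈ -1*-1≈1 (*-nonneg 0≤-1 0≤-1)
    where
    open RingProperties ring using (-‿distribˡ-*; -‿involutive)
    0≤-1 : 0# ≤ - 1#
    0≤-1 = ≤-respˡ-≈ (-‿inverseʳ 1#)
             (≤-respʳ-≈ (+-identityˡ (- 1#)) (+-mono-≤ (- 1#) 1≤0))
    -1*-1≈1 : - 1# * - 1# ≈ 1#
    -1*-1≈1 = trans (sym (-‿distribˡ-* 1# (- 1#)))
                (trans (-‿cong (*-identityˡ (- 1#))) (-‿involutive 1#))

-- Closure under unions of families indexed by small types is the usual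
-- axiom: with excluded middle, every collection of subsets is indexed by
-- a set of maps into Bool.  The empty set is the union over the empty type.
record TopologicalSpace : Set₁ where
  field
    setoid : Setoid 0ℓ 0ℓ
  open Setoid setoid using (_≈_) renaming (Carrier to Point) public
  field
    Open      : Pred (Pred Point 0ℓ) 0ℓ
    Open-resp : ∀ {A B} → A ≐ B → Open A → Open B
    Open-≈    : ∀ {A} → Open A → ∀ {x y} → x ≈ y → A x → A y
    Open-U    : Open U
    Open-∩    : ∀ {A B} → Open A → Open B → Open (A ∩ B)
    Open-⋃    : (I : Set) (A : I → Pred Point 0ℓ) →
                (∀ i → Open (A i)) → Open (⋃ I A)

Continuous : (X Y : TopologicalSpace) →
  Func (TopologicalSpace.setoid X) (TopologicalSpace.setoid Y) → Set₁
Continuous X Y f = ∀ {A} → Open Y A → Open X (Func.to f ⊢ A)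
  where open TopologicalSpace

data Borel (X : TopologicalSpace) : Pred (Pred (TopologicalSpace.Point X) 0ℓ) (lsuc 0ℓ) where
  open′  : ∀ {A} → TopologicalSpace.Open X A → Borel X A
  ∁′     : ∀ {A} → Borel X A → Borel X (∁ A)
  ⋃′     : ∀ {A} → (∀ n → Borel X (A n)) → Borel X (⋃ ℕ A)
  resp-≐ : ∀ {A B} → A ≐ B → Borel X A → Borel X B

BorelSet : TopologicalSpace → Set₁
BorelSet X = ∃ (Borel X)

module Design (ℝ : CompleteOrderedField) where

  open CompleteOrderedField ℝ public hiding (setoid)
  open AddSupremum _≤_ public using (_≤⁺_)

  ℝ-setoid : Setoid 0ℓ 0ℓ
  ℝ-setoid = CompleteOrderedField.setoid ℝ

  -- The coarsest topology making ι continuous; for ι an inclusion of a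
  -- subset of ℝ this is the subspace topology.
  inducedTopology : (S : Setoid 0ℓ 0ℓ) → Func S ℝ-setoid → TopologicalSpace
  inducedTopology S ι = record
    { setoid    = S
    ; Open      = λ A → ∀ x → A x → ∃[ ε ] (0# < ε × (∀ y → d y x < ε → A y))
    ; Open-resp = λ (A⊆B , B⊆A) oA x Bx →
        let ε , ε>0 , ball = oA x (B⊆A Bx)
        in  ε , ε>0 , λ y dy<ε → A⊆B (ball y dy<ε)
    ; Open-≈    = λ oA {x} {y} x≈y Ax →
        let ε , ε>0 , ball = oA x Ax
        in  ball y (<-respˡ-≈ (sym (d≈0 x≈y)) ε>0)
    ; Open-U    = λ x _ → 1# , (0≤1 , 0≉1) , λ _ _ → _
    ; Open-∩    = λ oA oB x (Ax , Bx) → meet (oA x Ax) (oB x Bx)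
    ; Open-⋃    = λ I A oA x (i , Ax) →
        let ε , ε>0 , ball = oA i x Ax
        in  ε , ε>0 , λ y dy<ε → i , ball y dy<ε
    }
    where
    open Setoid S using () renaming (Carrier to P; _≈_ to _≈ₛ_)
    open Func ι using (to; cong)

    d : P → P → Carrier
    d y x = ∣ to y - to x ∣

    <-respˡ-≈ : ∀ {x y z} → x ≈ y → x < z → y < z
    <-respˡ-≈ = ToStrict.<-respˡ-≈ _≈_ _≤_ trans ≤-respˡ-≈

    <-≤-trans : ∀ {x y z} → x < y → y ≤ z → x < z
    <-≤-trans = ToStrict.<-≤-trans _≈_ _≤_ sym ≤-trans antisym ≤-respʳ-≈

    d≈0 : ∀ {x y} → x ≈ₛ y → d y x ≈ 0#
    d≈0 {x} {y} x≈y = trans (⊔-cong diff (-‿cong diff)) (trans (⊔-cong refl -0≈0) 0⊔0≈0)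
      where
      open RingProperties ring using () renaming (-0#≈0# to -0≈0)
      open Max totalOrder using () renaming (⊔-idem to idem)
      0⊔0≈0 : 0# ⊔ 0# ≈ 0#
      0⊔0≈0 = idem 0#
      diff : to y - to x ≈ 0#
      diff = trans (+-congʳ (sym (cong x≈y))) (-‿inverseʳ (to x))

    Near : Pred P 0ℓ → P → Set
    Near A x = ∃[ ε ] (0# < ε × (∀ y → d y x < ε → A y))

    meet : ∀ {A B x} → Near A x → Near B x → Near (A ∩ B) x
    meet (ε , ε>0 , ballA) (δ , δ>0 , ballB) with total ε δ
    ... | inj₁ ε≤δ = ε , ε>0 , λ y h → ballA y h , ballB y (<-≤-trans h ε≤δ)
    ... | inj₂ δ≤ε = δ , δ>0 , λ y h → ballA y (<-≤-trans h δ≤ε) , ballB y h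

  ℝ-space : TopologicalSpace
  ℝ-space = inducedTopology ℝ-setoid (Identity.function ℝ-setoid)

  UnitInterval : Set
  UnitInterval = ∃[ t ] (0# ≤ t × t ≤ 1#)

  unitInterval-setoid : Setoid 0ℓ 0ℓ
  unitInterval-setoid = On.setoid {B = UnitInterval} ℝ-setoid proj₁

  unitInterval : TopologicalSpace
  unitInterval = inducedTopology unitInterval-setoid (record { to = proj₁ ; cong = λ eq → eq })

  PathConnected : TopologicalSpace → Set₁
  PathConnected X = ∀ x y → Σ (Func unitInterval-setoid setoid) λ γ →
    Continuous unitInterval X γ
    × Func.to γ (0# , ≤-refl , 0≤1) ≈ˣ x
    × Func.to γ (1# , 0≤1 , ≤-refl) ≈ˣ y
    where open TopologicalSpace X using (setoid) renaming (_≈_ to _≈ˣ_)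

  ConvergesTo : (ℕ → Carrier) → Carrier → Set
  ConvergesTo s L = ∀ ε → 0# < ε → ∃[ n₀ ] (∀ n → n₀ ℕ.≤ n → ∣ s n - L ∣ < ε)

  -- Since the total mass is 1, every measure value is a real number.
  record ProbabilityMeasure (X : TopologicalSpace) : Set₁ where
    field
      measure      : BorelSet X → Carrier
      measure-cong : ∀ {A B} → proj₁ A ≐ proj₁ B → measure A ≈ measure B
      nonneg       : ∀ A → 0# ≤ measure A
      σ-additive   : (A : ℕ → BorelSet X) →
                     (∀ i j → i ≢ j → proj₁ (A i) ⊥ proj₁ (A j)) →
                     ConvergesTo (λ n → sum {n} (λ i → measure (A (toℕ i))))
                                 (measure (_ , ⋃′ (λ n → proj₂ (A n))))
      total-mass   : measure (U , open′ (TopologicalSpace.Open-U X)) ≈ 1#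

  module Integration {X : TopologicalSpace} (μ : ProbabilityMeasure X) where
    open TopologicalSpace X using (Point)
    open ProbabilityMeasure μ

    -- The function ∑ᵢ coeff i · 1_{piece i}; it vanishes off the pieces.
    record SimpleFunction : Set₁ where
      field
        size         : ℕ
        coeff        : Fin size → Carrier
        coeff-nonneg : ∀ i → 0# ≤ coeff i
        piece        : Fin size → BorelSet X
        disjoint     : ∀ i j → i ≢ j → proj₁ (piece i) ⊥ proj₁ (piece j)

    open SimpleFunction

    ∫ˢ : SimpleFunction → Carrier
    ∫ˢ s = sum (λ i → coeff s i * measure (piece s i))

    -- Used only for g ≥ 0, so nothing has to be checked off the pieces.
    _Below_ : SimpleFunction → (Point → Carrier) → Set
    s Below g = ∀ i x → x ∈ proj₁ (piece s i) → coeff s i ≤ g x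

    IsIntegral⁺ : (Point → Carrier) → Carrier → Set₁
    IsIntegral⁺ g I = IsLub _≤_ (λ r → ∃[ s ] (s Below g × r ≈ ∫ˢ s)) I

    IsIntegral : (Point → Carrier) → Carrier → Set₁
    IsIntegral f I = ∃₂ λ I⁺ I⁻ →
      IsIntegral⁺ (λ x → f x ⊔ 0#) I⁺
      × IsIntegral⁺ (λ x → (- f x) ⊔ 0#) I⁻
      × I ≈ I⁺ - I⁻

  module FunctionSpace (S : Setoid 0ℓ 0ℓ) where
    open Setoid S using () renaming (Carrier to Point)

    Fun : Set
    Fun = Func S ℝ-setoid

    open Func public using () renaming (to to ⟦_⟧)

    _≗_ : Rel Fun 0ℓ
    f ≗ g = ∀ x → ⟦ f ⟧ x ≈ ⟦ g ⟧ x

    const : Carrier → Fun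
    const c = record { to = λ _ → c ; cong = λ _ → refl }

    _⊕_ : Fun → Fun → Fun
    f ⊕ g = record
      { to   = λ x → ⟦ f ⟧ x + ⟦ g ⟧ x
      ; cong = λ x≈y → +-cong (Func.cong f x≈y) (Func.cong g x≈y)
      }

    _⊙_ : Carrier → Fun → Fun
    c ⊙ f = record
      { to   = λ x → c * ⟦ f ⟧ x
      ; cong = λ x≈y → *-congˡ (Func.cong f x≈y)
      }

    record IsSubspace (W : Pred Fun p) : Set p where
      field
        W-resp : ∀ {f g} → f ≗ g → W f → W g
        W-0    : W (const 0#)
        W-+    : ∀ {f g} → W f → W g → W (f ⊕ g)
        W-*    : ∀ c {f} → W f → W (c ⊙ f)

    combination : ∀ {n} → (Fin n → Carrier) → (Fin n → Fun) → Point → Carrier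
    combination c b x = sum (λ i → c i * ⟦ b i ⟧ x)

    record IsBasis (W : Pred Fun p) {n : ℕ} (b : Fin n → Fun) : Set p where
      field
        member      : ∀ i → W (b i)
        independent : ∀ c → (∀ x → combination c b x ≈ 0#) → ∀ i → c i ≈ 0#
        spanning    : ∀ f → W f → ∃[ c ] (∀ x → ⟦ f ⟧ x ≈ combination c b x)

    HasDimension : Pred Fun p → ℕ → Set p
    HasDimension W n = ∃[ b ] IsBasis W {n} b

    Bounded : Pred Fun 0ℓ
    Bounded f = ∃[ B ] (∀ x → ∣ ⟦ f ⟧ x ∣ ≤ B)

    Range : Fun → Pred Carrier 0ℓ
    Range f r = ∃[ x ] (r ≈ ⟦ f ⟧ x)

  record TopologicalDesignProblem : Set₁ where
    field
      X : TopologicalSpace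
      μ : ProbabilityMeasure X
    open TopologicalSpace X public using (Point; setoid)
    open Integration μ public using (IsIntegral)
    open FunctionSpace setoid public
    field
      W            : Pred Fun 0ℓ
      W-subspace   : IsSubspace W
      W-finite-dim : ∃[ d ] HasDimension W d
      W-bounded    : ∀ f → W f → Bounded f
      W-continuous : ∀ f → W f → Continuous X ℝ-space f

    V : Pred Fun (lsuc 0ℓ)
    V f = (∃₂ λ w c → W w × f ≗ (w ⊕ const c)) × IsIntegral ⟦ f ⟧ 0#

  -- a / b in [0,∞] for a, b ≥ 0 not both zero.
  data Quotient (a b : Carrier) : Carrier ⁺ → Set where
    finite   : ¬ b ≈ 0# → Quotient a b [ a * b ⁻¹ ]
    infinite : b ≈ 0# → 0# < a → Quotient a b ⊤⁺

  module _ (D : TopologicalDesignProblem) where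
    open TopologicalDesignProblem D

    IsDesign : ∀ {N} → (Fin N → Point) → Set₁
    IsDesign {N} q = ∀ f → W f →
      IsIntegral ⟦ f ⟧ (fromℕ N ⁻¹ * sum (λ i → ⟦ f ⟧ (q i)))

    HasDesignOfSize : ℕ → Set₁
    HasDesignOfSize N = 1 ℕ.≤ N × ∃[ q ] IsDesign {N} q

    IsRatio : Carrier ⁺ → Set₁
    IsRatio ρ = ∃[ f ] (V f × ¬ f ≗ const 0# × ∃₂ λ s i →
      IsLub _≤_ (Range f) s × IsGlb _≤_ (Range f) i × Quotient s ∣ i ∣ ρ)

    -- The supremum is taken in [0,∞]; 0 is adjoined to the ratios because
    -- Carrier ⁺ also has negative elements.
    IsK : Carrier ⁺ → Set₁
    IsK K = IsLub _≤⁺_ (λ ρ → ρ ≡ [ 0# ] ⊎ IsRatio ρ) K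

-- Put m = n + 1.  A walk along edges of the cube [0,1]ᵐ through all its
-- vertices, read as a piecewise linear curve u : ℝ → [0,1]ᵐ, gives a problem on
-- X = ℝ with W spanned by the functions uᵢ − w, where w = 1/θ and θ is slightly
-- larger than k + 1.  The measure has mass 1 − w at a point p with u(p) = (0,…,0)
-- and mass w at a point q with u(q) = (1,…,1), so all these functions have mean 0.
-- The range of u has the whole cube as its convex hull, which gives K = θ − 1.
--
-- The walk only uses edges along which coordinate 0 varies or is constantly 1.
-- In a design of size N each coordinate sums to N w.  If θ is chosen so that N w
-- is never one of the integers in question, then for each i some design point must
-- lie inside an edge of direction i.  For i ≠ 0 such points have coordinate 0 equal
-- to 1, so N w ≥ n; but N ≤ n (k + 1) forces N w < n.
module Submission where

open import Defs
open import Axiom.ExcludedMiddle using (ExcludedMiddle)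
open import Data.Nat.Base as ℕ using (ℕ; zero; suc)
open import Data.Product.Base using (Σ; ∃₂; ∃-syntax; _×_; _,_; proj₁; proj₂)
open import Relation.Nullary.Construct.Add.Supremum using ([_])
open import Relation.Nullary.Negation.Core using (¬_)

open import Level using (0ℓ)
open import Algebra.Bundles using (CommutativeRing)
import Algebra.Construct.NaturalChoice.Max as Max
import Algebra.Properties.CommutativeSemigroup as CommutativeSemigroupProperties
import Algebra.Properties.Ring as RingProperties
import Algebra.Properties.Semiring.Mult.TCOptimised as Multiples
import Algebra.Properties.Semiring.Sum as SemiringSum
import Algebra.Solver.Ring as RingSolver
open import Algebra.Solver.Ring.AlmostCommutativeRing
  using (fromCommutativeRing; _-Raw-AlmostCommutative⟶_)
open import Data.Bool.Base using (Bool; true; false; not)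
open import Data.Empty using (⊥-elim)
open import Data.Fin.Base using (Fin; zero; suc; toℕ; fromℕ<)
import Data.Fin.Properties as Fin
open import Data.Integer.Base as ℤ using (ℤ; +_; -[1+_])
import Data.Integer.Properties as ℤ
open import Data.List.Base using (List; []; _∷_; cartesianProductWith)
open import Data.List.Membership.Propositional using (_∈_)
open import Data.List.Membership.Propositional.Properties using (∈-cartesianProductWith⁺)
open import Data.List.Relation.Unary.Any using (here; there)
import Data.Maybe.Base as Maybe
import Data.Nat.Properties as ℕ
import Data.Sign.Base as Sign
open import Data.Sum.Base using (_⊎_; inj₁; inj₂; [_,_]′)
open import Data.Vec.Base as Vec using (Vec; []; _∷_; lookup)
open import Data.Vec.Properties using (lookup-map; lookup-replicate; lookup∘tabulate)
open import Function.Base using (_∘_; id)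
open import Function.Bundles using (Func)
open import Relation.Binary.Bundles using (Setoid)
open import Relation.Binary.Consequences using (dec⇒weaklyDec)
open import Relation.Binary.Construct.Add.Supremum.NonStrict using (≤⁺-trans; [_])
open import Relation.Binary.Construct.Closure.ReflexiveTransitive as Star
  using (Star; _◅_; _◅◅_) renaming (ε to stay)
open import Relation.Binary.Core using (Rel)
open import Relation.Binary.Definitions using (Reflexive)
open import Relation.Binary.PropositionalEquality as ≡ using (_≡_; _≢_)
import Relation.Binary.Reasoning.Setoid as SetoidReasoning
open import Relation.Nullary.Decidable
  using (Dec; yes; no; does; decidable-stable; dec-true; dec-false)
open import Relation.Unary using (Pred; _≐_; _⊥_; ⋃)

-- A solver for ring identities with integer coefficients.

module IntegerSolver (R : CommutativeRing 0ℓ 0ℓ) where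
  open CommutativeRing R
  open Multiples semiring using (×-homo-+; ×1-homo-*; 1+×) renaming (_×_ to _·_)
  open RingProperties ring
    using (-‿distribˡ-*; -‿distribʳ-*; -‿involutive; -0#≈0#; -‿+-comm)
  open CommutativeSemigroupProperties +-commutativeSemigroup using (interchange)
  open SetoidReasoning setoid

  -- The multiples used here compute `1 · 1#` to `1#`, so the solver constants `:0` and `:1` denote
  -- `0#` and `1#` by computation.
  ⟦_⟧ℤ : ℤ → Carrier
  ⟦ + n ⟧ℤ      = n · 1#
  ⟦ -[1+ n ] ⟧ℤ = - (suc n · 1#)

  ⊖-homo : ∀ m n → ⟦ m ℤ.⊖ n ⟧ℤ ≈ m · 1# - n · 1#
  ⊖-homo m       zero    = sym (trans (+-congˡ -0#≈0#) (+-identityʳ _))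
  ⊖-homo zero    (suc n) = sym (+-identityˡ _)
  ⊖-homo (suc m) (suc n) = begin
    ⟦ suc m ℤ.⊖ suc n ⟧ℤ                ≡⟨ ≡.cong ⟦_⟧ℤ (ℤ.[1+m]⊖[1+n]≡m⊖n m n) ⟩
    ⟦ m ℤ.⊖ n ⟧ℤ                        ≈⟨ ⊖-homo m n ⟩
    m · 1# - n · 1#                     ≈⟨ +-identityˡ _ ⟨
    0# + (m · 1# - n · 1#)              ≈⟨ +-congʳ (-‿inverseʳ 1#) ⟨
    (1# - 1#) + (m · 1# - n · 1#)       ≈⟨ interchange _ _ _ _ ⟩
    (1# + m · 1#) + (- 1# - n · 1#)     ≈⟨ +-congˡ (-‿+-comm _ _) ⟩
    (1# + m · 1#) - (1# + n · 1#)       ≈⟨ +-cong (1+× m 1#) (-‿cong (1+× n 1#)) ⟨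
    suc m · 1# - suc n · 1#             ∎

  +-homo : ∀ i j → ⟦ i ℤ.+ j ⟧ℤ ≈ ⟦ i ⟧ℤ + ⟦ j ⟧ℤ
  +-homo (+ m)    (+ n)    = ×-homo-+ 1# m n
  +-homo (+ m)    -[1+ n ] = ⊖-homo m (suc n)
  +-homo -[1+ m ] (+ n)    = trans (⊖-homo n (suc m)) (+-comm _ _)
  +-homo -[1+ m ] -[1+ n ] = begin
    - (suc (suc (m ℕ.+ n)) · 1#)         ≡⟨ ≡.cong (λ k → - (suc k · 1#)) (ℕ.+-suc m n) ⟨
    - ((suc m ℕ.+ suc n) · 1#)           ≈⟨ -‿cong (×-homo-+ 1# (suc m) (suc n)) ⟩
    - (suc m · 1# + suc n · 1#)          ≈⟨ -‿+-comm _ _ ⟨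
    - (suc m · 1#) - suc n · 1#          ∎

  neg-homo : ∀ i → ⟦ ℤ.- i ⟧ℤ ≈ - ⟦ i ⟧ℤ
  neg-homo (+ zero)  = sym -0#≈0#
  neg-homo (+ suc n) = refl
  neg-homo -[1+ n ]  = sym (-‿involutive _)

  -◃-homo : ∀ n → ⟦ Sign.- ℤ.◃ n ⟧ℤ ≈ - (n · 1#)
  -◃-homo zero    = sym -0#≈0#
  -◃-homo (suc n) = refl

  +◃-homo : ∀ n → ⟦ Sign.+ ℤ.◃ n ⟧ℤ ≈ n · 1#
  +◃-homo zero    = refl
  +◃-homo (suc n) = refl

  *-homo : ∀ i j → ⟦ i ℤ.* j ⟧ℤ ≈ ⟦ i ⟧ℤ * ⟦ j ⟧ℤ
  *-homo (+ m)    (+ n)    = trans (+◃-homo (m ℕ.* n)) (×1-homo-* m n)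
  *-homo (+ m)    -[1+ n ] = trans (-◃-homo (m ℕ.* suc n))
    (trans (-‿cong (×1-homo-* m (suc n))) (-‿distribʳ-* _ _))
  *-homo -[1+ m ] (+ n)    = trans (-◃-homo (suc m ℕ.* n))
    (trans (-‿cong (×1-homo-* (suc m) n)) (-‿distribˡ-* _ _))
  *-homo -[1+ m ] -[1+ n ] = begin
    (suc m ℕ.* suc n) · 1#               ≈⟨ ×1-homo-* (suc m) (suc n) ⟩
    (suc m · 1#) * (suc n · 1#)          ≈⟨ -‿involutive _ ⟨
    - - ((suc m · 1#) * (suc n · 1#))    ≈⟨ -‿cong (-‿distribˡ-* _ _) ⟩
    - ((- (suc m · 1#)) * (suc n · 1#))  ≈⟨ -‿distribʳ-* _ _ ⟩
    - (suc m · 1#) * - (suc n · 1#)      ∎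

  morphism : ℤ.+-*-rawRing -Raw-AlmostCommutative⟶ fromCommutativeRing R
  morphism = record
    { ⟦_⟧    = ⟦_⟧ℤ
    ; +-homo = +-homo
    ; *-homo = *-homo
    ; -‿homo = neg-homo
    ; 0-homo = refl
    ; 1-homo = refl
    }

  open RingSolver ℤ.+-*-rawRing (fromCommutativeRing R) morphism
    (λ i j → Maybe.map (λ i≡j → reflexive (≡.cong ⟦_⟧ℤ i≡j)) (dec⇒weaklyDec ℤ._≟_ i j)) public
    using (solve; _:=_; con; _:+_; _:*_; _:-_; :-_; Polynomial)

  :0 :1 : ∀ {n} → Polynomial n
  :0 = con (+ 0)
  :1 = con (+ 1)

-- Elementary facts on ordered fields, finite sums and absolute values.

module OrderedField (ℝ : CompleteOrderedField) where
  open CompleteOrderedField ℝ hiding (zero)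
  open IntegerSolver commutativeRing using (solve; _:=_; _:+_; _:*_; _:-_; :-_; :0; :1) public
  open RingProperties ring public using (-0#≈0#)
  open SemiringSum semiring public
    using (sum-cong-≋; sum-replicate-zero; ∑-distrib-+; ∑-comm; *-distribˡ-sum)
  open Max totalOrder public
    using (⊔-lub; x≤x⊔y; x≤y⊔x; x≤y⇒x⊔y≈y; x≤y⇒y⊔x≈y)

  ≤-diff : ∀ {x y d} → 0# ≤ d → y ≈ x + d → x ≤ y
  ≤-diff {x} {y} {d} 0≤d y≈x+d = ≤-respʳ-≈ (trans (+-comm d x) (sym y≈x+d))
    (≤-respˡ-≈ (+-identityˡ x) (+-mono-≤ x 0≤d))

  0≤y-x : ∀ {x y} → x ≤ y → 0# ≤ y - x
  0≤y-x {x} x≤y = ≤-respˡ-≈ (-‿inverseʳ x) (+-mono-≤ (- x) x≤y)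

  +-mono₂-≤ : ∀ {x y u v} → x ≤ y → u ≤ v → x + u ≤ y + v
  +-mono₂-≤ {x} {y} {u} {v} x≤y u≤v = ≤-trans (+-mono-≤ u x≤y)
    (≤-respˡ-≈ (+-comm u y) (≤-respʳ-≈ (+-comm v y) (+-mono-≤ y u≤v)))

  0≤+ : ∀ {x y} → 0# ≤ x → 0# ≤ y → 0# ≤ x + y
  0≤+ 0≤x 0≤y = ≤-respˡ-≈ (+-identityˡ 0#) (+-mono₂-≤ 0≤x 0≤y)

  -‿anti-≤ : ∀ {x y} → x ≤ y → - y ≤ - x
  -‿anti-≤ {x} {y} x≤y = ≤-diff (0≤y-x x≤y)
    (solve 2 (λ x y → :- x := :- y :+ (y :- x)) refl x y)

  *-monoˡ-≤ : ∀ {x y z} → 0# ≤ z → x ≤ y → z * x ≤ z * y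
  *-monoˡ-≤ {x} {y} {z} 0≤z x≤y = ≤-diff (*-nonneg 0≤z (0≤y-x x≤y))
    (solve 3 (λ x y z → z :* y := z :* x :+ z :* (y :- x)) refl x y z)

  0<1 : 0# < 1#
  0<1 = 0≤1 , 0≉1

  ≤⇒¬> : ∀ {x y} → x ≤ y → ¬ y < x
  ≤⇒¬> x≤y (y≤x , y≉x) = y≉x (antisym y≤x x≤y)

  <⇒≉ : ∀ {x} → 0# < x → ¬ x ≈ 0#
  <⇒≉ (_ , 0≉x) x≈0 = 0≉x (sym x≈0)

  <-≤-trans : ∀ {x y z} → x < y → y ≤ z → x < z
  <-≤-trans (x≤y , x≉y) y≤z =
    ≤-trans x≤y y≤z , λ x≈z → x≉y (antisym x≤y (≤-respʳ-≈ (sym x≈z) y≤z))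

  ≤-<-trans : ∀ {x y z} → x ≤ y → y < z → x < z
  ≤-<-trans x≤y (y≤z , y≉z) =
    ≤-trans x≤y y≤z , λ x≈z → y≉z (antisym y≤z (≤-respˡ-≈ x≈z x≤y))

  <-respˡ : ∀ {x y z} → x ≈ y → x < z → y < z
  <-respˡ x≈y (x≤z , x≉z) = ≤-respˡ-≈ x≈y x≤z , λ y≈z → x≉z (trans x≈y y≈z)

  <-respʳ : ∀ {x y z} → y ≈ z → x < y → x < z
  <-respʳ y≈z (x≤y , x≉y) = ≤-respʳ-≈ y≈z x≤y , λ x≈z → x≉y (trans x≈z (sym y≈z))

  <-diff : ∀ {x y d} → 0# < d → y ≈ x + d → x < y
  <-diff {x} {y} {d} (0≤d , 0≉d) y≈x+d = ≤-diff 0≤d y≈x+d , λ x≈y → 0≉d (begin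
      0#           ≈⟨ -‿inverseʳ x ⟨
      x - x        ≈⟨ +-congʳ (trans x≈y y≈x+d) ⟩
      (x + d) - x  ≈⟨ solve 2 (λ x d → (x :+ d) :- x := d) refl x d ⟩
      d            ∎)
    where open SetoidReasoning setoid

  0<y-x : ∀ {x y} → x < y → 0# < y - x
  0<y-x {x} {y} (x≤y , x≉y) = 0≤y-x x≤y , λ 0≈y-x → x≉y (begin
      x            ≈⟨ +-identityˡ x ⟨
      0# + x       ≈⟨ +-congʳ 0≈y-x ⟩
      (y - x) + x  ≈⟨ solve 2 (λ x y → (y :- x) :+ x := y) refl x y ⟩
      y            ∎)
    where open SetoidReasoning setoid

  0<+ : ∀ {x y} → 0# < x → 0# ≤ y → 0# < x + y
  0<+ {x} {y} 0<x 0≤y = <-≤-trans 0<x (≤-diff 0≤y refl)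

  ⁻¹-inverseˡ : ∀ {x} → ¬ x ≈ 0# → x ⁻¹ * x ≈ 1#
  ⁻¹-inverseˡ x≉0 = trans (*-comm _ _) (⁻¹-inverse x≉0)

  *-cancelˡ : ∀ {x y z} → ¬ z ≈ 0# → z * x ≈ z * y → x ≈ y
  *-cancelˡ {x} {y} {z} z≉0 zx≈zy = begin
      x               ≈⟨ *-identityˡ x ⟨
      1# * x          ≈⟨ *-congʳ (⁻¹-inverseˡ z≉0) ⟨
      (z ⁻¹ * z) * x  ≈⟨ *-assoc _ _ _ ⟩
      z ⁻¹ * (z * x)  ≈⟨ *-congˡ zx≈zy ⟩
      z ⁻¹ * (z * y)  ≈⟨ *-assoc _ _ _ ⟨
      (z ⁻¹ * z) * y  ≈⟨ *-congʳ (⁻¹-inverseˡ z≉0) ⟩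
      1# * y          ≈⟨ *-identityˡ y ⟩
      y               ∎
    where open SetoidReasoning setoid

  0<* : ∀ {x y} → 0# < x → 0# < y → 0# < x * y
  0<* {x} {y} 0<x 0<y = *-nonneg (proj₁ 0<x) (proj₁ 0<y) , λ 0≈xy →
    proj₂ 0<y (*-cancelˡ (<⇒≉ 0<x) (trans (zeroʳ x) 0≈xy))

  *-cancelˡ-≤ : ∀ {x y z} → 0# < z → z * x ≤ z * y → x ≤ y
  *-cancelˡ-≤ {x} {y} {z} 0<z zx≤zy with total x y
  ... | inj₁ x≤y = x≤y
  ... | inj₂ y≤x = ≤-reflexive
    (*-cancelˡ (<⇒≉ 0<z) (antisym zx≤zy (*-monoˡ-≤ (proj₁ 0<z) y≤x)))

  0<x⇒0<x⁻¹ : ∀ {x} → 0# < x → 0# < x ⁻¹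
  0<x⇒0<x⁻¹ {x} 0<x =
    *-cancelˡ-≤ 0<x (≤-respˡ-≈ (sym (zeroʳ x)) (≤-respʳ-≈ (sym inv) 0≤1)) ,
    λ 0≈x⁻¹ → 0≉1 (trans (sym (zeroʳ x)) (trans (*-congˡ 0≈x⁻¹) inv))
    where inv = ⁻¹-inverse (<⇒≉ 0<x)

  0≤fromℕ : ∀ n → 0# ≤ fromℕ n
  0≤fromℕ zero    = ≤-refl
  0≤fromℕ (suc n) = 0≤+ 0≤1 (0≤fromℕ n)

  0<fromℕ : ∀ n → 0# < fromℕ (suc n)
  0<fromℕ n = 0<+ 0<1 (0≤fromℕ n)

  fromℕ-mono : ∀ {m n} → m ℕ.≤ n → fromℕ m ≤ fromℕ n
  fromℕ-mono {n = n} ℕ.z≤n = 0≤fromℕ n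
  fromℕ-mono (ℕ.s≤s m≤n)   = +-mono₂-≤ ≤-refl (fromℕ-mono m≤n)

  fromℕ-suc : ∀ n → fromℕ (suc n) ≈ fromℕ n + 1#
  fromℕ-suc n = +-comm 1# (fromℕ n)

  sum-mono : ∀ {n} {f g : Fin n → Carrier} → (∀ i → f i ≤ g i) → sum f ≤ sum g
  sum-mono {zero}  f≤g = ≤-refl
  sum-mono {suc n} f≤g = +-mono₂-≤ (f≤g zero) (sum-mono (λ i → f≤g (suc i)))

  sum-nonneg : ∀ {n} {f : Fin n → Carrier} → (∀ i → 0# ≤ f i) → 0# ≤ sum f
  sum-nonneg {zero}  0≤f = ≤-refl
  sum-nonneg {suc n} 0≤f = 0≤+ (0≤f zero) (sum-nonneg (λ i → 0≤f (suc i)))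

  sum-0 : ∀ {n} {f : Fin n → Carrier} → (∀ i → f i ≈ 0#) → sum f ≈ 0#
  sum-0 {n} f≈0 = trans (sum-cong-≋ f≈0) (sum-replicate-zero n)

  sum-const : ∀ n c → sum {n} (λ _ → c) ≈ fromℕ n * c
  sum-const zero    c = sym (zeroˡ c)
  sum-const (suc n) c = trans (+-congˡ (sum-const n c))
    (solve 2 (λ c k → c :+ k :* c := (:1 :+ k) :* c) refl c (fromℕ n))

  sum-* : ∀ {n} c (f : Fin n → Carrier) → sum (λ i → c * f i) ≈ c * sum f
  sum-* c f = sym (*-distribˡ-sum c f)

  sum-linear : ∀ {n} a b (f g : Fin n → Carrier) →
               sum (λ i → a * f i + b * g i) ≈ a * sum f + b * sum g
  sum-linear a b f g = trans (∑-distrib-+ (λ i → a * f i) (λ i → b * g i))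
    (+-cong (sum-* a f) (sum-* b g))

  sum-single : ∀ {n} {f : Fin n → Carrier} i → (∀ j → j ≢ i → f j ≈ 0#) → sum f ≈ f i
  sum-single {f = f} zero    f≈0 =
    trans (+-congˡ (sum-0 (λ j → f≈0 (suc j) λ ()))) (+-identityʳ _)
  sum-single {f = f} (suc i) f≈0 =
    trans (+-cong (f≈0 zero λ ()) (sum-single i (λ j j≢i → f≈0 (suc j) λ where ≡.refl → j≢i ≡.refl)))
      (+-identityˡ _)

  ≤-sum : ∀ {n} {f : Fin n → Carrier} → (∀ i → 0# ≤ f i) → ∀ i → f i ≤ sum f
  ≤-sum {suc n} {f} 0≤f zero    = ≤-diff (sum-nonneg (λ i → 0≤f (suc i))) refl
  ≤-sum {suc n} {f} 0≤f (suc i) = ≤-trans (≤-sum (λ i → 0≤f (suc i)) i)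
    (≤-diff (0≤f zero) (+-comm _ _))

  ⊔-pos : ∀ {x} → 0# ≤ x → x ⊔ 0# ≈ x
  ⊔-pos = x≤y⇒y⊔x≈y

  ⊔-neg : ∀ {x} → x ≤ 0# → x ⊔ 0# ≈ 0#
  ⊔-neg = x≤y⇒x⊔y≈y

  0≤⊔0 : ∀ x → 0# ≤ x ⊔ 0#
  0≤⊔0 x = x≤y⊔x x 0#

  x≤0⇒0≤-x : ∀ {x} → x ≤ 0# → 0# ≤ - x
  x≤0⇒0≤-x x≤0 = ≤-respˡ-≈ -0#≈0# (-‿anti-≤ x≤0)

  0≤x⇒-x≤0 : ∀ {x} → 0# ≤ x → - x ≤ 0#
  0≤x⇒-x≤0 0≤x = ≤-respʳ-≈ -0#≈0# (-‿anti-≤ 0≤x)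

  ⊔0-decompose : ∀ x → (x ⊔ 0#) - (- x ⊔ 0#) ≈ x
  ⊔0-decompose x = [ pos , neg ]′ (total 0# x)
    where
    pos : 0# ≤ x → (x ⊔ 0#) - (- x ⊔ 0#) ≈ x
    pos 0≤x = trans (+-cong (⊔-pos 0≤x) (-‿cong (⊔-neg (0≤x⇒-x≤0 0≤x))))
      (solve 1 (λ x → x :- :0 := x) refl x)
    neg : x ≤ 0# → (x ⊔ 0#) - (- x ⊔ 0#) ≈ x
    neg x≤0 = trans (+-cong (⊔-neg x≤0) (-‿cong (⊔-pos (x≤0⇒0≤-x x≤0))))
      (solve 1 (λ x → :0 :- (:- x) := x) refl x)

  ∣∣-cong : ∀ {x y} → x ≈ y → ∣ x ∣ ≈ ∣ y ∣
  ∣∣-cong x≈y = ⊔-cong x≈y (-‿cong x≈y)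

  ∣∣-pos : ∀ {x} → 0# ≤ x → ∣ x ∣ ≈ x
  ∣∣-pos 0≤x = x≤y⇒y⊔x≈y (≤-trans (0≤x⇒-x≤0 0≤x) 0≤x)

  ∣∣-neg : ∀ {x} → x ≤ 0# → ∣ x ∣ ≈ - x
  ∣∣-neg x≤0 = x≤y⇒x⊔y≈y (≤-trans x≤0 (x≤0⇒0≤-x x≤0))

  x≤∣x∣ : ∀ x → x ≤ ∣ x ∣
  x≤∣x∣ x = x≤x⊔y x (- x)

  -x≤∣x∣ : ∀ x → - x ≤ ∣ x ∣
  -x≤∣x∣ x = x≤y⊔x x (- x)

  ∣∣-≤ : ∀ {x y} → x ≤ y → - x ≤ y → ∣ x ∣ ≤ y
  ∣∣-≤ = ⊔-lub

  0≤∣x∣ : ∀ x → 0# ≤ ∣ x ∣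
  0≤∣x∣ x with total 0# x
  ... | inj₁ 0≤x = ≤-trans 0≤x (x≤∣x∣ x)
  ... | inj₂ x≤0 = ≤-trans (x≤0⇒0≤-x x≤0) (-x≤∣x∣ x)

  *-≤-∣∣ : ∀ {y M} c → y ≤ M → - y ≤ M → c * y ≤ ∣ c ∣ * M
  *-≤-∣∣ {y} {M} c y≤M -y≤M with total 0# c
  ... | inj₁ 0≤c = ≤-respʳ-≈ (*-congʳ (sym (∣∣-pos 0≤c))) (*-monoˡ-≤ 0≤c y≤M)
  ... | inj₂ c≤0 = ≤-respʳ-≈ (*-congʳ (sym (∣∣-neg c≤0)))
    (≤-respˡ-≈ (solve 2 (λ c y → (:- c) :* (:- y) := c :* y) refl c y)
      (*-monoˡ-≤ (x≤0⇒0≤-x c≤0) -y≤M))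

  ∣x-y∣≈∣y-x∣ : ∀ x y → ∣ x - y ∣ ≈ ∣ y - x ∣
  ∣x-y∣≈∣y-x∣ x y = antisym (half x y) (half y x)
    where
    half : ∀ x y → ∣ x - y ∣ ≤ ∣ y - x ∣
    half x y = ∣∣-≤
      (≤-respˡ-≈ (solve 2 (λ x y → :- (y :- x) := x :- y) refl x y) (-x≤∣x∣ (y - x)))
      (≤-respˡ-≈ (solve 2 (λ x y → y :- x := :- (x :- y)) refl x y) (x≤∣x∣ (y - x)))

-- Walks along a relation that visit given targets.

record Tour {V : Set} (R : Rel V 0ℓ) (start : V) (targets : List V) : Set where
  field
    stop    : ℕ → V
    length  : ℕ
    starts  : stop 0 ≡ start
    step    : ∀ l → R (stop l) (stop (suc l))
    visits  : ∀ {y} → y ∈ targets → ∃[ l ] (l ℕ.≤ length × stop l ≡ y)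

module _ {V : Set} {R : Rel V 0ℓ} where
  open Tour

  prepend : ∀ {x y ys} → R x y → Tour R y ys → Tour R x ys
  prepend {x} {y} xRy t = record
    { stop   = stop′
    ; length = suc (length t)
    ; starts = ≡.refl
    ; step   = step′
    ; visits = λ y∈ys → let l , l≤ , eq = visits t y∈ys in suc l , ℕ.s≤s l≤ , eq
    }
    where
    stop′ : ℕ → V
    stop′ zero    = x
    stop′ (suc l) = stop t l
    step′ : ∀ l → R (stop′ l) (stop′ (suc l))
    step′ zero    = ≡.subst (R x) (≡.sym (starts t)) xRy
    step′ (suc l) = step t l

  -- The targets are visited in list order: a path leads to the first, and a tour of the rest starts
  -- there. After the last target the walk stands still forever, which is where reflexivity enters.
  tour : Reflexive R → (∀ x y → Star R x y) → ∀ ys x → Tour R x ys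
  tour R-refl conn []       x = record
    { stop = λ _ → x ; length = 0 ; starts = ≡.refl ; step = λ _ → R-refl ; visits = λ () }
  tour R-refl conn (y ∷ ys) x = prepend* (conn x y) (record
    { stop = stop t ; length = length t ; starts = starts t ; step = step t
    ; visits = λ { (here ≡.refl) → 0 , ℕ.z≤n , starts t ; (there z∈ys) → visits t z∈ys } })
    where
    t = tour R-refl conn ys y
    prepend* : ∀ {x y zs} → Star R x y → Tour R y zs → Tour R x zs
    prepend* stay       t = t
    prepend* (r ◅ path) t = prepend r (prepend* path t)

-- Vertices and edges of the cube.

allVertices : ∀ n → List (Vec Bool n)
allVertices zero    = [] ∷ []
allVertices (suc n) = cartesianProductWith _∷_ (true ∷ false ∷ []) (allVertices n)

∈-allVertices : ∀ {n} (v : Vec Bool n) → v ∈ allVertices n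
∈-allVertices []      = here ≡.refl
∈-allVertices (b ∷ v) = ∈-cartesianProductWith⁺ _∷_ (∈-bools b) (∈-allVertices v)
  where
  ∈-bools : ∀ b → b ∈ (true ∷ false ∷ [])
  ∈-bools true  = here ≡.refl
  ∈-bools false = there (here ≡.refl)

AgreeOff : ∀ {n} → Fin n → Rel (Vec Bool n) 0ℓ
AgreeOff i v w = ∀ j → j ≢ i → lookup v j ≡ lookup w j

-- The ends may coincide, so a path can spend one step on every coordinate without asking whether
-- the bit changes.
CubeEdge : ∀ {n} → Rel (Vec Bool n) 0ℓ
CubeEdge v w = ∃[ i ] AgreeOff i v w

cube-connected : ∀ {n} (v w : Vec Bool n) → Star CubeEdge v w
cube-connected []      []      = stay
cube-connected (a ∷ v) (b ∷ w) =
  Star.gmap (a ∷_) extend (cube-connected v w) ◅◅ ((zero , head-change) ◅ stay)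
  where
  extend : ∀ {n} {v w : Vec Bool n} → CubeEdge v w → CubeEdge (a ∷ v) (a ∷ w)
  extend (i , agree) = suc i , λ where
    zero    _   → ≡.refl
    (suc j) j≢i → agree j (λ j≡i → j≢i (≡.cong suc j≡i))
  head-change : AgreeOff zero (a ∷ w) (b ∷ w)
  head-change zero    0≢0 = ⊥-elim (0≢0 ≡.refl)
  head-change (suc j) _   = ≡.refl

-- Coordinate zero is the height, which must be 1 while another coordinate changes.
Edge : ∀ {n} → Rel (Vec Bool (suc n)) 0ℓ
Edge v w = ∃[ i ] (AgreeOff i v w × (i ≡ zero ⊎ lookup v zero ≡ true))

edge-refl : ∀ {n} → Reflexive (Edge {n})
edge-refl {x = v} = zero , (λ j _ → ≡.refl {x = lookup v j}) , inj₁ ≡.refl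

-- Raise the height to 1, move among the vertices of the top face, then adjust the height to its
-- final value.
edge-connected : ∀ {n} (v w : Vec Bool (suc n)) → Star Edge v w
edge-connected (a ∷ v) (b ∷ w) =
  vertical v ◅ Star.gmap (true ∷_) horizontal (cube-connected v w) ◅◅ (vertical w ◅ stay)
  where
  vertical : ∀ {a b n} (v : Vec Bool n) → Edge (a ∷ v) (b ∷ v)
  vertical v = zero , (λ { zero 0≢0 → ⊥-elim (0≢0 ≡.refl) ; (suc j) _ → ≡.refl }) , inj₁ ≡.refl
  horizontal : ∀ {n} {v w : Vec Bool n} → CubeEdge v w → Edge (true ∷ v) (true ∷ w)
  horizontal (i , agree) = suc i , (λ where
    zero    _   → ≡.refl
    (suc j) j≢i → agree j (λ j≡i → j≢i (≡.cong suc j≡i))) , inj₂ ≡.refl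

cubeTour : ∀ n → Tour (Edge {n}) (Vec.replicate (suc n) false) (allVertices (suc n))
cubeTour n =
  tour (λ {v} → edge-refl {x = v}) edge-connected (allVertices (suc n)) (Vec.replicate (suc n) false)

-- Choice of a parameter none of whose small multiples is an integer.

module Generic (em : ∀ {ℓ} → ExcludedMiddle ℓ) (ℝ : CompleteOrderedField) where
  open CompleteOrderedField ℝ hiding (zero)
  open OrderedField ℝ

  *-monoˡ-< : ∀ {x y z} → 0# < z → x < y → z * x < z * y
  *-monoˡ-< {x} {y} {z} 0<z x<y = <-diff (0<* 0<z (0<y-x x<y))
    (solve 3 (λ x y z → z :* y := z :* x :+ z :* (y :- x)) refl x y z)

  dense : ∀ {x y} → x < y → ∃[ z ] (x < z × z < y)
  dense {x} {y} x<y = x + d ,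
    <-diff 0<d refl ,
    <-diff 0<d (sym (trans
      (solve 3 (λ x y h → (x :+ h :* (y :- x)) :+ h :* (y :- x) := x :+ ((:1 :+ :1) :* h) :* (y :- x))
        refl x y ((1# + 1#) ⁻¹))
      (trans (+-congˡ (*-congʳ (⁻¹-inverse (<⇒≉ 0<2))))
        (solve 2 (λ x y → x :+ :1 :* (y :- x) := y) refl x y))))
    where
    0<2 = 0<+ 0<1 0≤1
    d   = (1# + 1#) ⁻¹ * (y - x)
    0<d = 0<* (0<x⇒0<x⁻¹ 0<2) (0<y-x x<y)

  fromℕ-gap : ∀ {n x} → fromℕ n < x → x < fromℕ (suc n) → ∀ k → ¬ x ≈ fromℕ k
  fromℕ-gap {n} n<x x<1+n k x≈k with ℕ.≤-<-connex k n
  ... | inj₁ k≤n = ≤⇒¬> (fromℕ-mono k≤n) (<-respʳ x≈k n<x)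
  ... | inj₂ n<k = ≤⇒¬> (fromℕ-mono n<k) (<-respˡ x≈k x<1+n)

  -- The property is asked on a whole open interval, not at one point, so that finitely many
  -- conditions can be imposed one after another by shrinking.
  Subinterval : Carrier → Carrier → (Carrier → Set) → Set
  Subinterval a b P =
    ∃₂ λ a′ b′ → a ≤ a′ × b′ ≤ b × a′ < b′ × (∀ θ → a′ < θ → θ < b′ → P θ)

  -- The factor is `suc j` because the multiple by zero is always an integer. For w = 1/θ the
  -- condition says that N w is never `suc j`, whatever the natural number N.
  NoMultiple : ℕ → Carrier → Set
  NoMultiple j θ = ∀ k → ¬ fromℕ (suc j) * θ ≈ fromℕ k

  -- The excluded values of θ are the fractions k / (j + 1). If none lies in the interval, keep all
  -- of it. Otherwise start at such a fraction and stop at the next one or at `b`, whichever comes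
  -- first.
  avoid-multiples : ∀ j {a b} → a < b → Subinterval a b (NoMultiple j)
  avoid-multiples j {a} {b} a<b = by-cases em
    where
    J   = fromℕ (suc j)
    0<J = 0<fromℕ j

    J*J⁻¹* : ∀ x → J * (J ⁻¹ * x) ≈ x
    J*J⁻¹* x = trans (sym (*-assoc _ _ _))
      (trans (*-congʳ (⁻¹-inverse (<⇒≉ 0<J))) (*-identityˡ x))

    by-cases : Dec (∃[ k ] (a < J ⁻¹ * fromℕ k × J ⁻¹ * fromℕ k < b)) → Subinterval a b (NoMultiple j)
    by-cases (no none) = a , b , ≤-refl , ≤-refl , a<b , λ θ a<θ θ<b k Jθ≈k →
      let θ≈ = *-cancelˡ (<⇒≉ 0<J) (trans Jθ≈k (sym (J*J⁻¹* (fromℕ k))))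
      in  none (k , <-respʳ θ≈ a<θ , <-respˡ θ≈ θ<b)
    by-cases (yes (n , a<x , x<b)) = choose (total b x⁺)
      where
      x⁺ = J ⁻¹ * fromℕ (suc n)
      x<x⁺ : J ⁻¹ * fromℕ n < x⁺
      x<x⁺ = *-monoˡ-< (0<x⇒0<x⁻¹ 0<J) (<-diff 0<1 (fromℕ-suc n))
      gap : ∀ θ → J ⁻¹ * fromℕ n < θ → θ < x⁺ → NoMultiple j θ
      gap θ x<θ θ<x⁺ = fromℕ-gap {n}
        (<-respˡ (J*J⁻¹* (fromℕ n)) (*-monoˡ-< 0<J x<θ))
        (<-respʳ (J*J⁻¹* (fromℕ (suc n))) (*-monoˡ-< 0<J θ<x⁺))
      choose : b ≤ x⁺ ⊎ x⁺ ≤ b → Subinterval a b (NoMultiple j)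
      choose (inj₁ b≤x⁺) = _ , b , proj₁ a<x , ≤-refl , x<b , λ θ x<θ θ<b → gap θ x<θ (<-≤-trans θ<b b≤x⁺)
      choose (inj₂ x⁺≤b) = _ , x⁺ , proj₁ a<x , x⁺≤b , x<x⁺ , gap

  avoid-all-multiples : ∀ n {a b} → a < b → Subinterval a b (λ θ → ∀ j → j ℕ.< n → NoMultiple j θ)
  avoid-all-multiples zero    {a} {b} a<b = a , b , ≤-refl , ≤-refl , a<b , λ _ _ _ _ ()
  avoid-all-multiples (suc n) a<b =
    let a₁ , b₁ , a≤a₁ , b₁≤b , a₁<b₁ , P₁ = avoid-all-multiples n a<b
        a₂ , b₂ , a₁≤a₂ , b₂≤b₁ , a₂<b₂ , P₂ = avoid-multiples n a₁<b₁
    in  a₂ , b₂ , ≤-trans a≤a₁ a₁≤a₂ , ≤-trans b₂≤b₁ b₁≤b , a₂<b₂ , λ θ a₂<θ θ<b₂ j j<1+n →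
          [ P₁ θ (≤-<-trans a₁≤a₂ a₂<θ) (<-≤-trans θ<b₂ b₂≤b₁) j
          , (λ { ≡.refl → P₂ θ a₂<θ θ<b₂ }) ]′
          (ℕ.m<1+n⇒m<n∨m≡n j<1+n)

  generic : ∀ n {a b} → a < b →
            ∃[ θ ] (a < θ × θ < b × ∀ j → j ℕ.< n → NoMultiple j θ)
  generic n a<b =
    let a′ , b′ , a≤a′ , b′≤b , a′<b′ , P = avoid-all-multiples n a<b
        θ , a′<θ , θ<b′ = dense a′<b′
    in  θ , ≤-<-trans a≤a′ a′<θ , <-≤-trans θ<b′ b′≤b , P θ a′<θ θ<b′

-- Measures with two atoms and their integrals.

module Measures (em : ∀ {ℓ} → ExcludedMiddle ℓ) (ℝ : CompleteOrderedField) where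
  open Design ℝ hiding (zero)
  open OrderedField ℝ
  open SetoidReasoning ℝ-setoid

  module TwoPoint
    (X : TopologicalSpace)
    (borel-singleton : ∀ x → Borel X (λ y → TopologicalSpace._≈_ X y x))
    (p q : TopologicalSpace.Point X) (p≉q : ¬ TopologicalSpace._≈_ X p q)
    (a b : Carrier) (0≤a : 0# ≤ a) (0≤b : 0# ≤ b) (a+b≈1 : a + b ≈ 1#)
    where

    open TopologicalSpace X using (Point) renaming (_≈_ to _≈ˣ_)
    private module X = Setoid (TopologicalSpace.setoid X)

    expectation : (Point → Carrier) → Carrier
    expectation f = a * f p + b * f q

    expectation-cong : ∀ {f g} → (∀ x → f x ≈ g x) → expectation f ≈ expectation g
    expectation-cong f≈g = +-cong (*-congˡ (f≈g p)) (*-congˡ (f≈g q))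

    expectation-mono : ∀ {f g} → (∀ x → f x ≤ g x) → expectation f ≤ expectation g
    expectation-mono f≤g = +-mono₂-≤ (*-monoˡ-≤ 0≤a (f≤g p)) (*-monoˡ-≤ 0≤b (f≤g q))

    indicator : {P : Set} → Dec P → Carrier
    indicator (yes _) = 1#
    indicator (no _)  = 0#

    indicator-yes : {P : Set} (d : Dec P) → P → indicator d ≈ 1#
    indicator-yes (yes _) _ = refl
    indicator-yes (no ¬P) P = ⊥-elim (¬P P)

    indicator-no : {P : Set} (d : Dec P) → ¬ P → indicator d ≈ 0#
    indicator-no (yes P) ¬P = ⊥-elim (¬P P)
    indicator-no (no _)  _  = refl

    -- Abstract so that A and x can be inferred from χ A x.
    abstract
      χ : Pred Point 0ℓ → Point → Carrier
      χ A x = indicator (em {P = A x})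

      χ-∈ : ∀ {A x} → A x → χ A x ≈ 1#
      χ-∈ = indicator-yes em

      χ-∉ : ∀ {A x} → ¬ A x → χ A x ≈ 0#
      χ-∉ = indicator-no em

      0≤χ : ∀ A x → 0# ≤ χ A x
      0≤χ A x with em {P = A x}
      ... | yes _ = 0≤1
      ... | no  _ = ≤-refl

    χ-cong : ∀ {A B} → A ≐ B → ∀ x → χ A x ≈ χ B x
    χ-cong {A} {B} (A⊆B , B⊆A) x = by-cases em
      where
      by-cases : Dec (A x) → χ A x ≈ χ B x
      by-cases (yes Ax) = trans (χ-∈ Ax) (sym (χ-∈ (A⊆B Ax)))
      by-cases (no ¬Ax) = trans (χ-∉ ¬Ax) (sym (χ-∉ (¬Ax ∘ B⊆A)))

    -- Disjointness lets at most one of the sets contain `x`, so the partial sums are eventually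
    -- constant. Equality from some index on is stronger than convergence.
    χ-⋃ : (A : ℕ → Pred Point 0ℓ) → (∀ i j → i ≢ j → A i ⊥ A j) → ∀ x →
          ∃[ n₀ ] (∀ n → n₀ ℕ.≤ n → sum {n} (λ i → χ (A (toℕ i)) x) ≈ χ (⋃ ℕ A) x)
    χ-⋃ A disjoint x = by-cases em
      where
      by-cases : Dec (⋃ ℕ A x) → ∃[ n₀ ] (∀ n → n₀ ℕ.≤ n → sum {n} (λ i → χ (A (toℕ i)) x) ≈ χ (⋃ ℕ A) x)
      by-cases (no x∉⋃)         = 0 , λ n _ →
        trans (sum-0 {n} (λ i → χ-∉ (λ Aᵢx → x∉⋃ (toℕ i , Aᵢx)))) (sym (χ-∉ x∉⋃))
      -- The partial sum of length `n` has the indices below `n`, so `suc k` is the first length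
      -- that includes `k`.
      by-cases (yes (k , Aₖx)) = suc k , λ n k<n → begin
        sum {n} (λ i → χ (A (toℕ i)) x)  ≈⟨ sum-single (fromℕ< k<n) (λ j j≢k → χ-∉ (λ Aⱼx →
                                              disjoint (toℕ j) k (λ eq → j≢k (Fin.toℕ-injective
                                                (≡.trans eq (≡.sym (Fin.toℕ-fromℕ< k<n))))) (Aⱼx , Aₖx))) ⟩
        χ (A (toℕ (fromℕ< k<n))) x       ≈⟨ χ-∈ (≡.subst (λ i → A i x) (≡.sym (Fin.toℕ-fromℕ< k<n)) Aₖx) ⟩
        1#                               ≈⟨ χ-∈ (k , Aₖx) ⟨
        χ (⋃ ℕ A) x                      ∎

    twoPoint : ProbabilityMeasure X
    twoPoint = record
      { measure      = λ (A , _) → expectation (χ A)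
      ; measure-cong = λ A≐B → expectation-cong (χ-cong A≐B)
      ; nonneg       = λ (A , _) → 0≤+ (*-nonneg 0≤a (0≤χ A p)) (*-nonneg 0≤b (0≤χ A q))
      ; σ-additive   = λ A disjoint ε 0<ε →
          let n₁ , eqₚ = χ-⋃ (proj₁ ∘ A) disjoint p
              n₂ , eq_q = χ-⋃ (proj₁ ∘ A) disjoint q
          -- Beyond both thresholds the partial sums equal the measure of the union exactly, so the
          -- distance is 0 for every `ε`.
          in  n₁ ℕ.⊔ n₂ , λ n n₀≤n → <-respˡ (sym (∣x-y∣≈0 (trans (sum-linear {n} a b _ _)
                (+-cong (*-congˡ (eqₚ n (ℕ.m⊔n≤o⇒m≤o n₁ n₂ n₀≤n)))
                        (*-congˡ (eq_q n (ℕ.m⊔n≤o⇒n≤o n₁ n₂ n₀≤n))))))) 0<ε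
      ; total-mass   = trans (+-cong (trans (*-congˡ (χ-∈ _)) (*-identityʳ a))
                                     (trans (*-congˡ (χ-∈ _)) (*-identityʳ b))) a+b≈1
      }
      where
      ∣x-y∣≈0 : ∀ {x y} → x ≈ y → ∣ x - y ∣ ≈ 0#
      ∣x-y∣≈0 {x} {y} x≈y =
        let eq = trans (+-congʳ x≈y) (-‿inverseʳ y)
        in  trans (∣∣-pos (≤-reflexive (sym eq))) eq

    open Integration twoPoint
    open SimpleFunction

    -- At most one piece contains `x`. On that piece the sum is its coefficient; off all pieces the
    -- sum is 0, and nonnegativity of `g` gives the bound.
    pieces-≤ : ∀ {g} → (∀ x → 0# ≤ g x) → ∀ s → s Below g → ∀ x →
               sum (λ i → coeff s i * χ (proj₁ (piece s i)) x) ≤ g x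
    pieces-≤ {g} 0≤g s s≤g x = by-cases em
      where
      by-cases : Dec (∃[ i ] proj₁ (piece s i) x) → sum (λ i → coeff s i * χ (proj₁ (piece s i)) x) ≤ g x
      by-cases (no ∉pieces) = ≤-respˡ-≈
        (sym (sum-0 {size s} (λ i → trans (*-congˡ (χ-∉ (λ ∈i → ∉pieces (i , ∈i)))) (zeroʳ _)))) (0≤g x)
      by-cases (yes (i , ∈i)) = ≤-respˡ-≈ (sym (trans
        (sum-single i (λ j j≢i → trans (*-congˡ (χ-∉ (λ ∈j → disjoint s j i j≢i (∈j , ∈i)))) (zeroʳ _)))
        (trans (*-congˡ (χ-∈ ∈i)) (*-identityʳ _)))) (s≤g i x ∈i)

    ∫ˢ-expectation : ∀ s → ∫ˢ s ≈ expectation (λ x → sum (λ i → coeff s i * χ (proj₁ (piece s i)) x))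
    ∫ˢ-expectation s = trans
      (sum-cong-≋ {size s} (λ i → solve 5
        (λ c a b x y → c :* (a :* x :+ b :* y) := a :* (c :* x) :+ b :* (c :* y)) refl
        (coeff s i) a b (χ (proj₁ (piece s i)) p) (χ (proj₁ (piece s i)) q)))
      (sum-linear {size s} a b _ _)

    -- A simple function below `g` has at most the expectation of `g`, and the bound is attained by
    -- the one carried by the two singletons with values `g p` and `g q`.
    isIntegral⁺ : ∀ {g} → (∀ {x y} → x ≈ˣ y → g x ≈ g y) → (∀ x → 0# ≤ g x) →
                  IsIntegral⁺ g (expectation g)
    isIntegral⁺ {g} g-cong 0≤g = upper , least
      where
      upper : ∀ r → ∃[ s ] (s Below g × r ≈ ∫ˢ s) → r ≤ expectation g
      upper r (s , s≤g , r≈∫s) = ≤-respˡ-≈ (sym (trans r≈∫s (∫ˢ-expectation s)))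
        (expectation-mono (pieces-≤ 0≤g s s≤g))

      atom : Fin 2 → Point
      atom zero    = p
      atom (suc _) = q

      atom-disjoint : ∀ i j → i ≢ j → (_≈ˣ atom i) ⊥ (_≈ˣ atom j)
      atom-disjoint zero       zero       i≢j _           = i≢j ≡.refl
      atom-disjoint zero       (suc _)    _   (x≈p , x≈q) = p≉q (X.trans (X.sym x≈p) x≈q)
      atom-disjoint (suc _)    zero       _   (x≈q , x≈p) = p≉q (X.trans (X.sym x≈p) x≈q)
      atom-disjoint (suc zero) (suc zero) i≢j _           = i≢j ≡.refl

      s : SimpleFunction
      s = record
        { size         = 2
        ; coeff        = g ∘ atom
        ; coeff-nonneg = λ i → 0≤g (atom i)
        ; piece        = λ i → (_≈ˣ atom i) , borel-singleton (atom i)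
        ; disjoint     = atom-disjoint
        }

      expectation≈∫s : expectation g ≈ ∫ˢ s
      expectation≈∫s = sym (trans
        (+-cong (*-congˡ (+-cong (*-congˡ (χ-∈ X.refl)) (*-congˡ (χ-∉ (p≉q ∘ X.sym)))))
          (+-congʳ (*-congˡ (+-cong (*-congˡ (χ-∉ p≉q)) (*-congˡ (χ-∈ X.refl))))))
        (solve 4 (λ u v a b → u :* (a :* :1 :+ b :* :0) :+ (v :* (a :* :0 :+ b :* :1) :+ :0)
                              := a :* u :+ b :* v) refl (g p) (g q) a b))

      least : ∀ u → (∀ r → ∃[ s ] (s Below g × r ≈ ∫ˢ s) → r ≤ u) → expectation g ≤ u
      -- The pieces are classes of the equality of points, so `g` is constant on each by `g-cong`.
      least u ub = ub _ (s , (λ i x x≈ → ≤-reflexive (sym (g-cong x≈))) , expectation≈∫s)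

    open FunctionSpace (TopologicalSpace.setoid X) using (Fun; ⟦_⟧)

    expectation-decompose : ∀ f →
      expectation f ≈ expectation (λ x → f x ⊔ 0#) - expectation (λ x → (- f x) ⊔ 0#)
    expectation-decompose f = sym (trans
      (solve 6 (λ a b u v w z → (a :* u :+ b :* v) :- (a :* w :+ b :* z) := a :* (u :- w) :+ b :* (v :- z))
        refl a b _ _ _ _)
      (+-cong (*-congˡ (⊔0-decompose (f p))) (*-congˡ (⊔0-decompose (f q)))))

    module _ (f : Fun) where
      positive : IsIntegral⁺ (λ x → ⟦ f ⟧ x ⊔ 0#) (expectation (λ x → ⟦ f ⟧ x ⊔ 0#))
      positive = isIntegral⁺ (λ x≈y → ⊔-cong (Func.cong f x≈y) refl) (λ x → 0≤⊔0 _)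

      negative : IsIntegral⁺ (λ x → (- ⟦ f ⟧ x) ⊔ 0#) (expectation (λ x → (- ⟦ f ⟧ x) ⊔ 0#))
      negative = isIntegral⁺ (λ x≈y → ⊔-cong (-‿cong (Func.cong f x≈y)) refl) (λ x → 0≤⊔0 _)

      isIntegral : ∀ {I} → I ≈ expectation ⟦ f ⟧ → IsIntegral ⟦ f ⟧ I
      isIntegral I≈ = _ , _ , positive , negative , trans I≈ (expectation-decompose ⟦ f ⟧)

      -- Least upper bounds are unique. This turns the design condition and membership in `V` into
      -- equations between expectations.
      isIntegral-unique : ∀ {I} → IsIntegral ⟦ f ⟧ I → I ≈ expectation ⟦ f ⟧
      isIntegral-unique (I⁺ , I⁻ , isI⁺ , isI⁻ , I≈) = trans I≈ (trans
        (+-cong (lub-unique isI⁺ positive) (-‿cong (lub-unique isI⁻ negative)))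
        (sym (expectation-decompose ⟦ f ⟧)))
        where
        lub-unique : ∀ {S : Pred Carrier _} {s t} → IsLub _≤_ S s → IsLub _≤_ S t → s ≈ t
        lub-unique (s-ub , s-least) (t-ub , t-least) = antisym (s-least _ t-ub) (t-least _ s-ub)

-- Piecewise linear interpolation.

module Interpolation (ℝ : CompleteOrderedField) where
  open Design ℝ hiding (zero)
  open OrderedField ℝ

  -- The truncation of `t` to the unit interval. As a difference of two positive parts it inherits a
  -- Lipschitz bound from the rules for sums, multiples and positive parts.
  clamp : Carrier → Carrier
  clamp t = (t ⊔ 0#) - ((t - 1#) ⊔ 0#)

  clamp-cong : ∀ {s t} → s ≈ t → clamp s ≈ clamp t
  clamp-cong s≈t = +-cong (⊔-cong s≈t refl) (-‿cong (⊔-cong (+-congʳ s≈t) refl))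

  clamp-low : ∀ {t} → t ≤ 0# → clamp t ≈ 0#
  clamp-low {t} t≤0 = trans (+-cong (⊔-neg t≤0) (-‿cong (⊔-neg
      (≤-trans (≤-diff 0≤1 (solve 1 (λ t → t := (t :- :1) :+ :1) refl t)) t≤0))))
    (-‿inverseʳ 0#)

  clamp-mid : ∀ {t} → 0# ≤ t → t ≤ 1# → clamp t ≈ t
  clamp-mid {t} 0≤t t≤1 = trans (+-cong (⊔-pos 0≤t) (-‿cong (⊔-neg
      (≤-diff (0≤y-x t≤1) (solve 1 (λ t → :0 := (t :- :1) :+ (:1 :- t)) refl t)))))
    (solve 1 (λ t → t :- :0 := t) refl t)

  clamp-high : ∀ {t} → 1# ≤ t → clamp t ≈ 1#
  clamp-high {t} 1≤t = trans (+-cong (⊔-pos (≤-trans 0≤1 1≤t)) (-‿cong (⊔-pos (0≤y-x 1≤t))))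
    (solve 1 (λ t → t :- (t :- :1) := :1) refl t)

  0≤clamp≤1 : ∀ t → 0# ≤ clamp t × clamp t ≤ 1#
  0≤clamp≤1 t = [ low , [ mid , high ]′ (total t 1#) ]′ (total t 0#)
    where
    low : t ≤ 0# → 0# ≤ clamp t × clamp t ≤ 1#
    low t≤0 = ≤-reflexive (sym (clamp-low t≤0)) , ≤-respˡ-≈ (sym (clamp-low t≤0)) 0≤1
    mid : t ≤ 1# → 0# ≤ t → 0# ≤ clamp t × clamp t ≤ 1#
    mid t≤1 0≤t = ≤-respʳ-≈ (sym (clamp-mid 0≤t t≤1)) 0≤t , ≤-respˡ-≈ (sym (clamp-mid 0≤t t≤1)) t≤1
    high : 1# ≤ t → 0# ≤ t → 0# ≤ clamp t × clamp t ≤ 1#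
    high 1≤t _ = ≤-respʳ-≈ (sym (clamp-high 1≤t)) 0≤1 , ≤-reflexive (clamp-high 1≤t)

  -- The piecewise linear function through the points (l, F l) for l ≤ L, constant outside [0, L].
  -- Each unit interval contributes one ramp, whose height is the increment of `F`.
  interpolate : (ℕ → Carrier) → ℕ → Carrier → Carrier
  interpolate F zero    t = F 0
  interpolate F (suc L) t = interpolate F L t + (F (suc L) - F L) * clamp (t - fromℕ L)

  interpolate-cong : ∀ F L {s t} → s ≈ t → interpolate F L s ≈ interpolate F L t
  interpolate-cong F zero    s≈t = refl
  interpolate-cong F (suc L) s≈t =
    +-cong (interpolate-cong F L s≈t) (*-congˡ (clamp-cong (+-congʳ s≈t)))

  interpolate-left : ∀ F L {t} → t ≤ fromℕ L → interpolate F (suc L) t ≈ interpolate F L t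
  interpolate-left F L {t} t≤L = trans
    (+-congˡ (trans (*-congˡ (clamp-low (≤-diff (0≤y-x t≤L)
      (solve 2 (λ t l → :0 := (t :- l) :+ (l :- t)) refl t (fromℕ L))))) (zeroʳ _)))
    (+-identityʳ _)

  interpolate-right : ∀ F L {t} → fromℕ L ≤ t → interpolate F L t ≈ F L
  interpolate-right F zero    L≤t = refl
  interpolate-right F (suc L) {t} L+1≤t = trans
    (+-cong (interpolate-right F L (≤-trans (fromℕ-mono (ℕ.n≤1+n L)) L+1≤t))
            (*-congˡ (clamp-high (≤-diff (0≤y-x L+1≤t)
              (solve 2 (λ t l → t :- l := :1 :+ (t :- (:1 :+ l))) refl t (fromℕ L))))))
    (solve 2 (λ a b → a :+ (b :- a) :* :1 := b) refl (F L) (F (suc L)))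

  interpolate-fromℕ : ∀ F {l L} → l ℕ.≤ L → interpolate F L (fromℕ l) ≈ F l
  interpolate-fromℕ F {l} {zero}  ℕ.z≤n = refl
  interpolate-fromℕ F {l} {suc L} l≤1+L with ℕ.m≤n⇒m<n∨m≡n l≤1+L
  ... | inj₁ (ℕ.s≤s l≤L) = trans (interpolate-left F L (fromℕ-mono l≤L)) (interpolate-fromℕ F l≤L)
  ... | inj₂ ≡.refl      = interpolate-right F (suc L) ≤-refl

  -- The index and the weights depend on `L` and `t` only, not on `F`. Applied to all coordinates of
  -- the walk at once, `linear` places the curve point on one edge of the cube.
  record Segment (L : ℕ) (t : Carrier) : Set where
    field
      index  : ℕ
      λ₀ λ₁  : Carrier
      0≤λ₀   : 0# ≤ λ₀
      0≤λ₁   : 0# ≤ λ₁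
      λ₀+λ₁  : λ₀ + λ₁ ≈ 1#
      linear : ∀ F → interpolate F L t ≈ λ₀ * F index + λ₁ * F (suc index)

  segment : ∀ L t → Segment L t
  -- For `L = 0` the interpolant is constantly `F 0`; the second end gets weight 0.
  segment zero t = record
    { index = 0 ; λ₀ = 1# ; λ₁ = 0# ; 0≤λ₀ = 0≤1 ; 0≤λ₁ = ≤-refl ; λ₀+λ₁ = +-identityʳ 1#
    ; linear = λ F → solve 2 (λ a b → a := :1 :* a :+ :0 :* b) refl (F 0) (F 1) }
  segment (suc L) t with total t (fromℕ L)
  ... | inj₁ t≤L = let open Segment (segment L t) in record
    { index = index ; λ₀ = λ₀ ; λ₁ = λ₁ ; 0≤λ₀ = 0≤λ₀ ; 0≤λ₁ = 0≤λ₁ ; λ₀+λ₁ = λ₀+λ₁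
    ; linear = λ F → trans (interpolate-left F L t≤L) (linear F) }
  -- To the right of `L` the earlier ramps are complete, and the clamped weight also covers the
  -- points beyond `L + 1`.
  ... | inj₂ L≤t = record
    { index = L ; λ₀ = 1# - s ; λ₁ = s
    ; 0≤λ₀ = 0≤y-x (proj₂ (0≤clamp≤1 _)) ; 0≤λ₁ = proj₁ (0≤clamp≤1 _)
    ; λ₀+λ₁ = solve 1 (λ s → (:1 :- s) :+ s := :1) refl s
    ; linear = λ F → trans (+-congʳ (interpolate-right F L L≤t))
        (solve 3 (λ a b s → a :+ (b :- a) :* s := (:1 :- s) :* a :+ s :* b) refl (F L) (F (suc L)) s) }
    where s = clamp (t - fromℕ L)

  -- Lipschitz functions: continuity and closure rules.

  module _ {S : Setoid 0ℓ 0ℓ} (ι : Func S ℝ-setoid) where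
    open Setoid S using () renaming (Carrier to P)
    open Func ι using () renaming (to to at)

    -- Taking both orders of x and y makes the bound two-sided.
    Lipschitz : (P → Carrier) → Set
    Lipschitz f = ∃[ M ] (0# < M × ∀ x y → f y - f x ≤ M * ∣ at y - at x ∣)

    lipschitz-continuous : (f : Func S ℝ-setoid) → Lipschitz (Func.to f) →
                           Continuous (inducedTopology S ι) ℝ-space f
    lipschitz-continuous f (M , 0<M , lip) openA x Afx =
      let ε , 0<ε , ball = openA (to x) Afx
      in  M ⁻¹ * ε , 0<* (0<x⇒0<x⁻¹ 0<M) 0<ε , λ y near → ball (to y) (close y 0<ε near)
      where
      open Func f
      close : ∀ y {ε} → 0# < ε → ∣ at y - at x ∣ < M ⁻¹ * ε → ∣ to y - to x ∣ < ε
      close y {ε} 0<ε near = ≤-<-trans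
        (∣∣-≤ (lip x y) (≤-respˡ-≈ (solve 2 (λ a b → a :- b := :- (b :- a)) refl (to x) (to y))
          (≤-respʳ-≈ (*-congˡ (∣x-y∣≈∣y-x∣ _ _)) (lip y x))))
        (<-diff (0<* 0<M (0<y-x near)) (sym eq))
        where
        d = ∣ at y - at x ∣
        eq : M * d + M * (M ⁻¹ * ε - d) ≈ ε
        eq = trans (solve 4 (λ m n d e → m :* d :+ m :* (n :* e :- d) := (m :* n) :* e) refl M (M ⁻¹) d ε)
               (trans (*-congʳ (⁻¹-inverse (<⇒≉ 0<M))) (*-identityˡ ε))

    lipschitz-resp : ∀ {f g} → (∀ x → f x ≈ g x) → Lipschitz f → Lipschitz g
    lipschitz-resp f≈g (M , 0<M , lip) = M , 0<M , λ x y →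
      ≤-respˡ-≈ (+-cong (f≈g y) (-‿cong (f≈g x))) (lip x y)

    lipschitz-const : ∀ c → Lipschitz (λ _ → c)
    lipschitz-const c = 1# , 0<1 , λ x y →
      ≤-respˡ-≈ (sym (-‿inverseʳ c)) (*-nonneg 0≤1 (0≤∣x∣ _))

    lipschitz-ι : Lipschitz at
    lipschitz-ι = 1# , 0<1 , λ x y → ≤-respʳ-≈ (sym (*-identityˡ _)) (x≤∣x∣ _)

    lipschitz-+ : ∀ {f g} → Lipschitz f → Lipschitz g → Lipschitz (λ x → f x + g x)
    lipschitz-+ {f} {g} (M , 0<M , lf) (N , 0<N , lg) = M + N , 0<+ 0<M (proj₁ 0<N) , λ x y →
      ≤-respˡ-≈ (solve 4 (λ a b c d → (a :- b) :+ (c :- d) := (a :+ c) :- (b :+ d)) refl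
          (f y) (f x) (g y) (g x))
        (≤-respʳ-≈ (solve 3 (λ m n d → m :* d :+ n :* d := (m :+ n) :* d) refl M N _)
          (+-mono₂-≤ (lf x y) (lg x y)))

    lipschitz-* : ∀ {f} c → Lipschitz f → Lipschitz (λ x → c * f x)
    -- The summand 1 keeps the constant positive when `c` is 0.
    lipschitz-* {f} c (M , 0<M , lf) = 1# + ∣ c ∣ * M , 0<+ 0<1 (*-nonneg (0≤∣x∣ c) (proj₁ 0<M)) , λ x y →
      ≤-trans (≤-respˡ-≈ (solve 3 (λ c a b → c :* (a :- b) := c :* a :- c :* b) refl c (f y) (f x))
        (*-≤-∣∣ c (lf x y) (≤-respˡ-≈ (solve 2 (λ a b → a :- b := :- (b :- a)) refl (f x) (f y))
          (≤-respʳ-≈ (*-congˡ (∣x-y∣≈∣y-x∣ _ _)) (lf y x)))))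
        (≤-diff (0≤∣x∣ (at y - at x))
          (solve 3 (λ c m d → (:1 :+ c :* m) :* d := c :* (m :* d) :+ d) refl ∣ c ∣ M _))

    -- If `f y` is nonpositive, the difference is at most 0. Otherwise it is `f y - (f x ⊔ 0#)`,
    -- which is at most `f y - f x`.
    lipschitz-⊔0 : ∀ {f} → Lipschitz f → Lipschitz (λ x → f x ⊔ 0#)
    lipschitz-⊔0 {f} (M , 0<M , lf) = M , 0<M , λ x y → bound x y (total (f y) 0#)
      where
      bound : ∀ x y → f y ≤ 0# ⊎ 0# ≤ f y → (f y ⊔ 0#) - (f x ⊔ 0#) ≤ M * ∣ at y - at x ∣
      bound x y (inj₁ fy≤0) = ≤-trans
        (≤-respˡ-≈ (sym (trans (+-congʳ (⊔-neg fy≤0)) (+-identityˡ _))) (0≤x⇒-x≤0 (0≤⊔0 (f x))))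
        (*-nonneg (proj₁ 0<M) (0≤∣x∣ _))
      bound x y (inj₂ 0≤fy) = ≤-trans
        (≤-respˡ-≈ (+-congʳ (sym (⊔-pos 0≤fy))) (+-mono₂-≤ ≤-refl (-‿anti-≤ (x≤x⊔y (f x) 0#))))
        (lf x y)

    lipschitz-sum : ∀ {n} {f : Fin n → P → Carrier} → (∀ i → Lipschitz (f i)) →
                    Lipschitz (λ x → sum (λ i → f i x))
    lipschitz-sum {zero}  lf = lipschitz-const 0#
    lipschitz-sum {suc n} lf = lipschitz-+ (lf zero) (lipschitz-sum (λ i → lf (suc i)))

  id-ι : Func ℝ-setoid ℝ-setoid
  id-ι = record { to = λ x → x ; cong = λ eq → eq }

  lipschitz-clamp : ∀ c → Lipschitz id-ι (λ t → clamp (t - c))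
  lipschitz-clamp c = lipschitz-+ id-ι (lipschitz-⊔0 id-ι shift)
    (lipschitz-resp id-ι (λ x → solve 1 (λ a → (:- :1) :* a := :- a) refl _)
      (lipschitz-* id-ι (- 1#) (lipschitz-⊔0 id-ι (lipschitz-+ id-ι shift (lipschitz-const id-ι _)))))
    where
    shift : Lipschitz id-ι (λ t → t - c)
    shift = lipschitz-+ id-ι (lipschitz-ι id-ι) (lipschitz-const id-ι (- c))

  lipschitz-interpolate : ∀ F L → Lipschitz id-ι (interpolate F L)
  lipschitz-interpolate F zero    = lipschitz-const id-ι _
  lipschitz-interpolate F (suc L) = lipschitz-+ id-ι (lipschitz-interpolate F L)
    (lipschitz-* id-ι _ (lipschitz-clamp (fromℕ L)))

  ℝ-pathConnected : PathConnected ℝ-space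
  ℝ-pathConnected x y =
    γ ,
    (λ {A} → lipschitz-continuous ι γ lip {A}) ,
    solve 2 (λ x y → x :+ (y :- x) :* :0 := x) refl x y ,
    solve 2 (λ x y → x :+ (y :- x) :* :1 := y) refl x y
    where
    ι : Func unitInterval-setoid ℝ-setoid
    ι = record { to = proj₁ ; cong = λ eq → eq }
    γ : Func unitInterval-setoid ℝ-setoid
    γ = record { to = λ t → x + (y - x) * proj₁ t ; cong = λ s≈t → +-congˡ (*-congˡ s≈t) }
    lip : Lipschitz ι (Func.to γ)
    lip = lipschitz-+ ι (lipschitz-const ι x) (lipschitz-* ι (y - x) (lipschitz-ι ι))

-- The curve along the edges of the cube.

module Construction (em : ∀ {ℓ} → ExcludedMiddle ℓ) (ℝ : CompleteOrderedField) where
  open Design ℝ hiding (zero)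
  open OrderedField ℝ
  open Interpolation ℝ
  open FunctionSpace ℝ-setoid
  open Measures em ℝ

  module Cube (n : ℕ) (w : Carrier) (0<w : 0# < w) (2w≤1 : w + w ≤ 1#) where

    m : ℕ
    m = suc n

    open Tour (cubeTour n)

    0≤1-w : 0# ≤ 1# - w
    0≤1-w = ≤-trans (0≤y-x 2w≤1) (≤-diff (proj₁ 0<w)
      (solve 1 (λ w → :1 :- w := (:1 :- (w :+ w)) :+ w) refl w))

    bit : Bool → Carrier
    bit true  = 1#
    bit false = 0#

    0≤bit : ∀ b → 0# ≤ bit b
    0≤bit true  = 0≤1
    0≤bit false = ≤-refl

    bit≤1 : ∀ b → bit b ≤ 1#
    bit≤1 true  = ≤-refl
    bit≤1 false = 0≤1

    bit-not : ∀ b → bit (not b) ≈ 1# - bit b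
    bit-not true  = sym (-‿inverseʳ 1#)
    bit-not false = solve 0 (:1 := :1 :- :0) refl

    sum-bits : ∀ {N} (b : Fin N → Bool) → ∃[ k ] sum (λ l → bit (b l)) ≈ fromℕ k
    sum-bits {zero}  b = 0 , refl
    sum-bits {suc N} b with b zero | sum-bits (λ l → b (suc l))
    ... | true  | k , eq = suc k , +-congˡ eq
    ... | false | k , eq = k , trans (+-congˡ eq) (+-identityˡ _)

    coordinate : Fin m → ℕ → Carrier
    coordinate i l = bit (lookup (stop l) i)

    u : Fin m → Carrier → Carrier
    u i = interpolate (coordinate i) length

    vertex-point : ∀ v → ∃[ x ] (∀ i → u i x ≈ bit (lookup v i))
    vertex-point v =
      let l , l≤length , eq = visits (∈-allVertices v)
      in  fromℕ l , λ i → trans (interpolate-fromℕ _ l≤length)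
            (reflexive (≡.cong (λ v → bit (lookup v i)) eq))

    0≤u : ∀ i x → 0# ≤ u i x
    0≤u i x = ≤-respʳ-≈ (sym (linear _)) (0≤+
      (*-nonneg 0≤λ₀ (0≤bit (lookup (stop index) i)))
      (*-nonneg 0≤λ₁ (0≤bit (lookup (stop (suc index)) i))))
      where open Segment (segment length x)

    u≤1 : ∀ i x → u i x ≤ 1#
    u≤1 i x = ≤-respˡ-≈ (sym (linear _))
      (≤-respʳ-≈ (trans (+-cong (*-identityʳ λ₀) (*-identityʳ λ₁)) λ₀+λ₁)
        (+-mono₂-≤ (*-monoˡ-≤ 0≤λ₀ (bit≤1 (lookup (stop index) i)))
                   (*-monoˡ-≤ 0≤λ₁ (bit≤1 (lookup (stop (suc index)) i)))))
      where open Segment (segment length x)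

    -- The edge may be degenerate and the point may be one of its ends. All that is used is that the
    -- other coordinates are bits and that the height is 1 unless the direction is `zero`.
    direction : Carrier → Fin m
    direction x = proj₁ (step index)
      where open Segment (segment length x)

    -- Both ends of the edge have the same bit in coordinate `i`, so every convex combination of
    -- them has it too.
    off-direction : ∀ x i → direction x ≢ i → ∃[ b ] u i x ≈ bit b
    off-direction x i d≢i = b , trans (linear _) (trans
      (+-congˡ (*-congˡ (reflexive (≡.cong bit (≡.sym (proj₁ (proj₂ (step index)) i (d≢i ∘ ≡.sym)))))))
      (trans (solve 3 (λ a b c → a :* c :+ b :* c := (a :+ b) :* c) refl λ₀ λ₁ (bit b))
        (trans (*-congʳ λ₀+λ₁) (*-identityˡ _))))
      where
      open Segment (segment length x)
      b = lookup (stop index) i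

    -- The definition of `Edge` puts the first end at height 1, and agreement off the direction puts
    -- the second end there.
    height-1 : ∀ x → direction x ≢ zero → u zero x ≈ 1#
    height-1 x d≢0 = trans (linear _) (trans
      (+-cong (*-congˡ (reflexive (≡.cong bit top)))
              (*-congˡ (reflexive (≡.cong bit (≡.trans (≡.sym (agree zero (d≢0 ∘ ≡.sym))) top)))))
      (trans (+-cong (*-identityʳ λ₀) (*-identityʳ λ₁)) λ₀+λ₁))
      where
      open Segment (segment length x)
      agree = proj₁ (proj₂ (step index))
      top : lookup (stop index) zero ≡ true
      top = [ ⊥-elim ∘ d≢0 , id ]′ (proj₂ (proj₂ (step index)))

    -- Combinations of the shifted coordinates and their values at vertices.

    g : Fin m → Fun
    g i = record { to = λ x → u i x - w ; cong = λ x≈y → +-congʳ (interpolate-cong _ length x≈y) }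

    comb : (Fin m → Carrier) → Carrier → Carrier
    comb c = combination c g

    vertexTerm : (Fin m → Carrier) → Vec Bool m → Fin m → Carrier
    vertexTerm c v i = c i * (bit (lookup v i) - w)

    vertexComb : (Fin m → Carrier) → Vec Bool m → Carrier
    vertexComb c v = sum (vertexTerm c v)

    comb-vertex : ∀ c v → ∃[ x ] comb c x ≈ vertexComb c v
    comb-vertex c v =
      let x , eq = vertex-point v
      in  x , sum-cong-≋ {m} (λ i → *-congˡ {c i} (+-congʳ { - w} (eq i)))

    comb-segment : ∀ c x → let open Segment (segment length x) in
      comb c x ≈ λ₀ * vertexComb c (stop index) + λ₁ * vertexComb c (stop (suc index))
    comb-segment c x = trans (sum-cong-≋ {m} pointwise)
      (sum-linear λ₀ λ₁ (vertexTerm c (stop index)) (vertexTerm c (stop (suc index))))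
      where
      open Segment (segment length x)
      pointwise : ∀ i → c i * (u i x - w) ≈
        λ₀ * vertexTerm c (stop index) i + λ₁ * vertexTerm c (stop (suc index)) i
      -- Replacing `w` by `(λ₀ + λ₁) * w` lets the affine expression `u i x - w` split along the two
      -- ends.
      pointwise i = trans
        (*-congˡ (+-cong (linear _) (-‿cong (sym (trans (*-congʳ λ₀+λ₁) (*-identityˡ w))))))
        (solve 6 (λ c r s p q w → c :* ((r :* p :+ s :* q) :- (r :+ s) :* w)
                                  := r :* (c :* (p :- w)) :+ s :* (c :* (q :- w)))
          refl (c i) λ₀ λ₁ _ _ w)

    origin : Vec Bool m
    origin = Vec.replicate m false

    -- In the coordinates u − w, the point −v/κ with κ = (1 − w)/w lies in the cube:
    -- it is a convex combination of the opposite vertex and the origin.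
    reflection : ∀ c v → w * vertexComb c v +
      (w * vertexComb c (Vec.map not v) + (1# - (w + w)) * vertexComb c origin) ≈ 0#
    reflection c v = trans (sym (trans (sum-linear {m} w 1# A (λ i → w * B i + z * C i))
        (+-congˡ (trans (*-identityˡ _) (sum-linear {m} w z B C)))))
      (sum-0 {f = λ i → w * A i + 1# * (w * B i + z * C i)} term)
      where
      z = 1# - (w + w)
      A = vertexTerm c v
      B = vertexTerm c (Vec.map not v)
      C = vertexTerm c origin
      term : ∀ i → w * A i + 1# * (w * B i + z * C i) ≈ 0#
      term i = trans
        (+-congˡ (*-congˡ (+-cong
          (*-congˡ (*-congˡ (+-congʳ (trans
            (reflexive (≡.cong bit (lookup-map i not v))) (bit-not (lookup v i))))))
          (*-congˡ (*-congˡ (+-congʳ (reflexive (≡.cong bit (lookup-replicate i false)))))))))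
        (solve 3 (λ c b w → w :* (c :* (b :- w)) :+ :1 :* (w :* (c :* ((:1 :- b) :- w))
                              :+ (:1 :- (w :+ w)) :* (c :* (:0 :- w))) := :0)
          refl (c i) (bit (lookup v i)) w)

    -- Each value is a convex combination of two vertex values, so vertices suffice. At a vertex,
    -- `reflection` expresses minus the left side through values at the opposite vertex and the
    -- origin, with weights w and 1 - 2w. Both values are at least `i`, and the weights add up to 1
    -- - w.
    comb-bound : ∀ c i → (∀ x → i ≤ comb c x) → ∀ x → w * comb c x ≤ (1# - w) * ∣ i ∣
    comb-bound c i i≤ x = ≤-respˡ-≈
      (sym (trans (*-congˡ (comb-segment c x))
        (solve 5 (λ w r s p q → w :* (r :* p :+ s :* q) := r :* (w :* p) :+ s :* (w :* q)) refl w λ₀ λ₁ _ _)))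
      (≤-respʳ-≈ (trans (solve 3 (λ r s b → r :* b :+ s :* b := (r :+ s) :* b) refl λ₀ λ₁ _)
          (trans (*-congʳ λ₀+λ₁) (*-identityˡ _)))
        (+-mono₂-≤ (*-monoˡ-≤ 0≤λ₀ (vertex-bound (stop index)))
                   (*-monoˡ-≤ 0≤λ₁ (vertex-bound (stop (suc index))))))
      where
      open Segment (segment length x)

      i≤vertexComb : ∀ v → i ≤ vertexComb c v
      i≤vertexComb v = let y , eq = comb-vertex c v in ≤-respʳ-≈ eq (i≤ y)

      vertex-bound : ∀ v → w * vertexComb c v ≤ (1# - w) * ∣ i ∣
      vertex-bound v = ≤-trans
        (≤-respˡ-≈ (sym (trans
            (solve 2 (λ a r → a := (a :+ r) :- r) refl (w * vertexComb c v) r)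
            (trans (+-congʳ (reflection c v)) (+-identityˡ _))))
          (-‿anti-≤ (+-mono₂-≤ (*-monoˡ-≤ (proj₁ 0<w) (i≤vertexComb (Vec.map not v)))
                              (*-monoˡ-≤ (0≤y-x 2w≤1) (i≤vertexComb origin)))))
        (≤-respˡ-≈ (solve 2 (λ w i → (:1 :- w) :* (:- i) := :- (w :* i :+ (:1 :- (w :+ w)) :* i)) refl w i)
          (*-monoˡ-≤ 0≤1-w (-x≤∣x∣ i)))
        where
        r = w * vertexComb c (Vec.map not v) + (1# - (w + w)) * vertexComb c origin

    -- The two atoms and the resulting design problem.

    at-vertex : Vec Bool m → Carrier
    at-vertex v = proj₁ (vertex-point v)

    u-at-vertex : ∀ v i → u i (at-vertex v) ≈ bit (lookup v i)
    u-at-vertex v = proj₂ (vertex-point v)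

    p q : Carrier
    p = at-vertex origin
    q = at-vertex (Vec.replicate m true)

    u-p : ∀ i → u i p ≈ 0#
    u-p i = trans (u-at-vertex origin i) (reflexive (≡.cong bit (lookup-replicate i false)))

    u-q : ∀ i → u i q ≈ 1#
    u-q i = trans (u-at-vertex (Vec.replicate m true) i) (reflexive (≡.cong bit (lookup-replicate i true)))

    p≉q : ¬ p ≈ q
    p≉q p≈q = 0≉1 (trans (sym (u-p zero)) (trans (interpolate-cong _ length p≈q) (u-q zero)))

    -- The complement is open, with radius `∣ x - c ∣` at `x`; excluded middle identifies the double
    -- complement with the singleton.
    borel-singleton : ∀ c → Borel ℝ-space (_≈ c)
    borel-singleton c = resp-≐ ((λ {x} → decidable-stable em) , λ x≈c x≉c → x≉c x≈c)
      (∁′ (open′ {A = λ x → ¬ x ≈ c} λ x x≉c → ∣ x - c ∣ , 0<∣x-c∣ x x≉c , avoids x))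
      where
      0<∣x-c∣ : ∀ x → ¬ x ≈ c → 0# < ∣ x - c ∣
      0<∣x-c∣ x x≉c = 0≤∣x∣ (x - c) , λ 0≈∣x-c∣ → x≉c (antisym
        (≤-diff (≤-respʳ-≈ (solve 2 (λ x c → :- (x :- c) := c :- x) refl x c)
          (x≤0⇒0≤-x (≤-respʳ-≈ (sym 0≈∣x-c∣) (x≤∣x∣ (x - c)))))
          (solve 2 (λ x c → c := x :+ (c :- x)) refl x c))
        (≤-diff (≤-respʳ-≈ (solve 2 (λ x c → :- :- (x :- c) := x :- c) refl x c)
          (x≤0⇒0≤-x (≤-respʳ-≈ (sym 0≈∣x-c∣) (-x≤∣x∣ (x - c)))))
          (solve 2 (λ x c → x := c :+ (x :- c)) refl x c)))
      avoids : ∀ x y → ∣ y - x ∣ < ∣ x - c ∣ → ¬ y ≈ c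
      avoids x y near y≈c = ≤⇒¬>
        (≤-reflexive (trans (∣x-y∣≈∣y-x∣ x c) (∣∣-cong (+-congʳ (sym y≈c))))) near

    1-w+w≈1 : (1# - w) + w ≈ 1#
    1-w+w≈1 = solve 1 (λ w → (:1 :- w) :+ w := :1) refl w

    open TwoPoint ℝ-space borel-singleton p q p≉q (1# - w) w 0≤1-w (proj₁ 0<w) 1-w+w≈1
      using (twoPoint; expectation; expectation-cong; isIntegral; isIntegral-unique)

    -- The mass at `q` is chosen for this: every coordinate is 0 at `p` and 1 at `q`, so its mean is
    -- `w`.
    expectation-g : ∀ i → expectation ⟦ g i ⟧ ≈ 0#
    expectation-g i = trans
      (+-cong (*-congˡ (+-congʳ (u-p i))) (*-congˡ (+-congʳ (u-q i))))
      (solve 1 (λ w → (:1 :- w) :* (:0 :- w) :+ w :* (:1 :- w) := :0) refl w)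

    expectation-comb : ∀ c → expectation (comb c) ≈ 0#
    expectation-comb c = trans (sym (sum-linear (1# - w) w (at p) (at q)))
      (sum-0 {f = λ i → (1# - w) * at p i + w * at q i} λ i → trans
        (solve 5 (λ a b c x y → a :* (c :* x) :+ b :* (c :* y) := c :* (a :* x :+ b :* y)) refl
          (1# - w) w (c i) (⟦ g i ⟧ p) (⟦ g i ⟧ q))
        (trans (*-congˡ (expectation-g i)) (zeroʳ (c i))))
      where
      at : Carrier → Fin m → Carrier
      at x i = c i * ⟦ g i ⟧ x

    IsComb : Pred Fun 0ℓ
    IsComb f = ∃[ c ] (∀ x → ⟦ f ⟧ x ≈ comb c x)

    isComb-subspace : IsSubspace IsComb
    isComb-subspace = record
      { W-resp = λ f≗g (c , eq) → c , λ x → trans (sym (f≗g x)) (eq x)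
      ; W-0    = (λ _ → 0#) , λ x → sym (sum-0 {f = λ i → 0# * ⟦ g i ⟧ x} λ i → zeroˡ _)
      ; W-+    = λ (c , eq) (d , eq′) → (λ i → c i + d i) , λ x → trans (+-cong (eq x) (eq′ x))
          (trans (sym (∑-distrib-+ (λ i → c i * ⟦ g i ⟧ x) (λ i → d i * ⟦ g i ⟧ x)))
            (sum-cong-≋ {m} (λ i → sym (distribʳ (⟦ g i ⟧ x) (c i) (d i)))))
      ; W-*    = λ a (c , eq) → (λ i → a * c i) , λ x → trans (*-congˡ (eq x))
          (trans (sym (sum-* a (λ i → c i * ⟦ g i ⟧ x)))
            (sum-cong-≋ {m} (λ i → sym (*-assoc a (c i) (⟦ g i ⟧ x)))))
      }

    unit : Fin m → Fin m → Carrier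
    unit i j = bit (does (j Fin.≟ i))

    unit-≡ : ∀ i → unit i i ≈ 1#
    unit-≡ i = reflexive (≡.cong bit (dec-true (i Fin.≟ i) ≡.refl))

    unit-≢ : ∀ {i j} → j ≢ i → unit i j ≈ 0#
    unit-≢ {i} {j} j≢i = reflexive (≡.cong bit (dec-false (j Fin.≟ i) j≢i))

    isComb-g : ∀ i → IsComb (g i)
    isComb-g i = unit i , λ x → sym (trans
      (sum-single {f = λ j → unit i j * ⟦ g j ⟧ x} i (λ j j≢i → trans (*-congʳ (unit-≢ j≢i)) (zeroˡ _)))
      (trans (*-congʳ (unit-≡ i)) (*-identityˡ _)))

    -- The coefficient c i is the difference of the values at the i-th unit
    -- vertex and at the origin.
    g-independent : ∀ c → (∀ x → comb c x ≈ 0#) → ∀ i → c i ≈ 0#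
    g-independent c comb≈0 i = begin
      c i                                              ≈⟨ *-identityʳ (c i) ⟨
      c i * 1#                                         ≈⟨ *-congˡ (unit-≡ i) ⟨
      c i * unit i i                                   ≈⟨ sum-single i off-i ⟨
      sum (λ j → c j * unit i j)                       ≈⟨ sum-cong-≋ {m} term ⟨
      sum (λ j → 1# * vertexTerm c v j + - 1# * vertexTerm c origin j)
        ≈⟨ sum-linear 1# (- 1#) (vertexTerm c v) (vertexTerm c origin) ⟩
      1# * vertexComb c v + - 1# * vertexComb c origin
        ≈⟨ +-cong (*-congˡ (vertexComb≈0 v)) (*-congˡ (vertexComb≈0 origin)) ⟩
      1# * 0# + - 1# * 0#                              ≈⟨ +-cong (zeroʳ _) (zeroʳ _) ⟩
      0# + 0#                                          ≈⟨ +-identityˡ 0# ⟩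
      0#                                               ∎
      where
      open SetoidReasoning ℝ-setoid using (begin_; step-≈-⟩; step-≈-⟨; _∎)

      v = Vec.tabulate (λ j → does (j Fin.≟ i))

      off-i : ∀ j → j ≢ i → c j * unit i j ≈ 0#
      off-i j j≢i = trans (*-congˡ (unit-≢ j≢i)) (zeroʳ (c j))

      term : ∀ j → 1# * vertexTerm c v j + - 1# * vertexTerm c origin j ≈ c j * unit i j
      term j = trans
        (+-cong
          (*-congˡ (*-congˡ (+-congʳ (reflexive
            (≡.cong bit (lookup∘tabulate (λ j → does (j Fin.≟ i)) j))))))
          (*-congˡ (*-congˡ (+-congʳ (reflexive (≡.cong bit (lookup-replicate j false)))))))
        (solve 3 (λ c b w → :1 :* (c :* (b :- w)) :+ :- :1 :* (c :* (:0 :- w)) := c :* b)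
          refl (c j) (unit i j) w)

      vertexComb≈0 : ∀ v → vertexComb c v ≈ 0#
      vertexComb≈0 v = let x , eq = comb-vertex c v in trans (sym eq) (comb≈0 x)

    comb-bounded : ∀ f → IsComb f → Bounded f
    comb-bounded f (c , eq) = sum (λ i → ∣ c i ∣ * 1#) , λ x → ≤-respˡ-≈ (∣∣-cong (sym (eq x)))
      (∣∣-≤ (sum-mono (λ i → *-≤-∣∣ (c i) (g≤1 i x) (-g≤1 i x)))
            (≤-respˡ-≈ (trans (sum-* (- 1#) (λ i → c i * ⟦ g i ⟧ x)) (-1*x≈-x _))
              (sum-mono (λ i → negated i x))))
      where
      -1*x≈-x : ∀ x → - 1# * x ≈ - x
      -1*x≈-x = solve 1 (λ x → :- :1 :* x := :- x) refl
      g≤1 : ∀ i x → ⟦ g i ⟧ x ≤ 1#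
      g≤1 i x = ≤-trans
        (≤-diff (proj₁ 0<w) (solve 2 (λ u w → u := (u :- w) :+ w) refl (u i x) w))
        (u≤1 i x)
      -g≤1 : ∀ i x → - ⟦ g i ⟧ x ≤ 1#
      -g≤1 i x = ≤-diff (0≤+ (0≤u i x) 0≤1-w)
        (solve 2 (λ u w → :1 := :- (u :- w) :+ (u :+ (:1 :- w))) refl (u i x) w)
      negated : ∀ i x → - 1# * (c i * ⟦ g i ⟧ x) ≤ ∣ c i ∣ * 1#
      negated i x = ≤-respˡ-≈
        (solve 2 (λ c y → c :* (:- y) := :- :1 :* (c :* y)) refl (c i) (⟦ g i ⟧ x))
        (*-≤-∣∣ (c i) (-g≤1 i x)
          (≤-respˡ-≈ (solve 1 (λ y → y := :- :- y) refl (⟦ g i ⟧ x)) (g≤1 i x)))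

    comb-continuous : ∀ f → IsComb f → Continuous ℝ-space ℝ-space f
    comb-continuous f (c , eq) {A} = lipschitz-continuous id-ι f
      (lipschitz-resp id-ι (λ x → sym (eq x)) (lipschitz-sum id-ι {m} (λ i →
        lipschitz-* id-ι (c i) (lipschitz-+ id-ι
          (lipschitz-interpolate (coordinate i) length) (lipschitz-const id-ι (- w)))))) {A}

    D : TopologicalDesignProblem
    D = record
      { X            = ℝ-space
      ; μ            = twoPoint
      ; W            = IsComb
      ; W-subspace   = isComb-subspace
      ; W-finite-dim = m , g , record
        { member = isComb-g ; independent = g-independent ; spanning = λ _ combf → combf }
      ; W-bounded    = comb-bounded
      ; W-continuous = comb-continuous
      }

    -- The space `V` and the value of `K`.

    open TopologicalDesignProblem D using (V)

    V-g : ∀ i → V (g i)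
    V-g i = (g i , 0# , isComb-g i , λ x → sym (+-identityʳ _)) , isIntegral (g i) (sym (expectation-g i))

    -- Combinations have mean 0, so a combination plus a constant has that constant as its mean, and
    -- membership in `V` forces the constant to be 0.
    V⇒IsComb : ∀ f → V f → IsComb f
    V⇒IsComb f ((h , c , (d , h≈comb) , f≗h+c) , ∫f≈0) = d , λ x → trans (f≗h+c x)
      (trans (+-congˡ c≈0) (trans (+-identityʳ _) (h≈comb x)))
      where
      c≈0 : c ≈ 0#
      c≈0 = trans (sym (trans (+-congʳ (expectation-comb d)) (+-identityˡ c)))
        (trans (solve 4 (λ w x y c → ((:1 :- w) :* x :+ w :* y) :+ c
                                  := (:1 :- w) :* (x :+ c) :+ w :* (y :+ c))
                 refl w (comb d p) (comb d q) c)
          (trans (expectation-cong (λ x → sym (trans (f≗h+c x) (+-congʳ (h≈comb x)))))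
            (sym (isIntegral-unique f ∫f≈0))))

    V-dimension : HasDimension V m
    V-dimension = g , record { member = V-g ; independent = g-independent ; spanning = V⇒IsComb }

    -- For w = 1/θ this is θ - 1.
    κ : Carrier
    κ = (1# - w) * w ⁻¹

    κ*w≈1-w : κ * w ≈ 1# - w
    κ*w≈1-w = trans (*-assoc _ _ _) (trans (*-congˡ (⁻¹-inverseˡ (<⇒≉ 0<w))) (*-identityʳ _))

    0≤κ : 0# ≤ κ
    0≤κ = *-nonneg 0≤1-w (proj₁ (0<x⇒0<x⁻¹ 0<w))

    sup≤κ∣inf∣ : ∀ f → V f → ∀ {s i} → IsLub _≤_ (Range f) s → IsGlb _≤_ (Range f) i → s ≤ κ * ∣ i ∣
    sup≤κ∣inf∣ f Vf {s} {i} (_ , s-least) (i-lower , _) = s-least _ λ { r (x , r≈fx) →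
      *-cancelˡ-≤ 0<w (≤-respˡ-≈ (*-congˡ (sym (trans r≈fx (eq x))))
        (≤-respʳ-≈ (trans (*-congʳ (sym κ*w≈1-w))
            (solve 3 (λ k w i → (k :* w) :* i := w :* (k :* i)) refl κ w ∣ i ∣))
          (comb-bound c i (λ y → ≤-respʳ-≈ (eq y) (i-lower _ (y , refl))) x))) }
      where
      c  = proj₁ (V⇒IsComb f Vf)
      eq = proj₂ (V⇒IsComb f Vf)

    ratio≤κ : ∀ {ρ} → IsRatio D ρ → ρ ≤⁺ [ κ ]
    -- An infinite ratio would have infimum 0 and positive supremum, but infimum 0 forces the
    -- supremum to be at most 0.
    ratio≤κ (f , Vf , _ , s , i , lub , glb , infinite ∣i∣≈0 0<s) = ⊥-elim (≤⇒¬>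
      (≤-respʳ-≈ (trans (*-congˡ ∣i∣≈0) (zeroʳ κ)) (sup≤κ∣inf∣ f Vf lub glb)) 0<s)
    ratio≤κ (f , Vf , _ , s , i , lub , glb , finite ∣i∣≉0) = [ *-cancelˡ-≤
      (0≤∣x∣ i , λ 0≈∣i∣ → ∣i∣≉0 (sym 0≈∣i∣))
      (≤-respˡ-≈ (sym (trans
          (solve 3 (λ a s b → a :* (s :* b) := s :* (a :* b)) refl ∣ i ∣ s (∣ i ∣ ⁻¹))
          (trans (*-congˡ (⁻¹-inverse ∣i∣≉0)) (*-identityʳ s))))
        (≤-respʳ-≈ (*-comm κ ∣ i ∣) (sup≤κ∣inf∣ f Vf lub glb))) ]

    ∣-w∣≈w : ∣ - w ∣ ≈ w
    ∣-w∣≈w = trans (∣∣-neg (0≤x⇒-x≤0 (proj₁ 0<w))) (solve 1 (λ w → :- :- w := w) refl w)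

    -- The supremum 1 - w of `g zero` is taken at `q` and the infimum -w at `p`. The ratio is
    -- therefore `κ`, which makes `κ` the exact value of `K`.
    ratio-g₀ : IsRatio D [ (1# - w) * ∣ - w ∣ ⁻¹ ]
    ratio-g₀ = g zero , V-g zero , (λ g≈0 → <⇒≉ 0<w (trans
        (solve 1 (λ w → w := :- (:0 :- w)) refl w)
        (trans (-‿cong (trans (+-congʳ (sym (u-p zero))) (g≈0 p))) -0#≈0#))) ,
      1# - w , - w ,
      ((λ { r (x , r≈) → ≤-respˡ-≈ (sym r≈) (+-mono-≤ (- w) (u≤1 zero x)) }) ,
       (λ b ub → ub _ (q , +-congʳ (sym (u-q zero))))) ,
      ((λ { r (x , r≈) → ≤-respʳ-≈ (sym r≈) (≤-respˡ-≈ (+-identityˡ (- w)) (+-mono-≤ (- w) (0≤u zero x))) }) ,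
       (λ b lb → lb _ (p , trans (sym (+-identityˡ (- w))) (+-congʳ (sym (u-p zero)))))) ,
      finite (λ ∣-w∣≈0 → <⇒≉ 0<w (trans (sym ∣-w∣≈w) ∣-w∣≈0))

    K≡κ : IsK D [ κ ]
    K≡κ = (λ { ρ (inj₁ ≡.refl) → [ 0≤κ ] ; ρ (inj₂ ratio) → ratio≤κ ratio }) ,
      λ ρ ub → ≤⁺-trans _≤_ ≤-trans
        [ ≤-reflexive (*-congˡ (⁻¹-cong (sym ∣-w∣≈w))) ] (ub _ (inj₂ ratio-g₀))

    -- Designs whose size N has nonintegral N w are large.

    module _ {N : ℕ} (r : Fin N → Carrier) (design : IsDesign D r)
             (1≤N : 1 ℕ.≤ N) (Nw-nonintegral : ∀ k → ¬ fromℕ N * w ≈ fromℕ k) where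

      -- Since `g i` has mean 0, its values at the design points sum to 0; adding `w` once per point
      -- gives the sum of the coordinate.
      design-sum : ∀ i → sum (λ l → u i (r l)) ≈ fromℕ N * w
      design-sum i = begin
        U                                                ≈⟨ difference U Z ⟨
        (1# * U + - 1# * Z) + Z                          ≈⟨ +-congʳ (sum-linear {N} 1# (- 1#) _ _) ⟨
        sum {N} (λ l → 1# * u i (r l) + - 1# * w) + Z    ≈⟨ +-congʳ (sum-cong-≋ {N} pointwise) ⟩
        sum {N} (λ l → ⟦ g i ⟧ (r l)) + Z                ≈⟨ +-congʳ sum≈0 ⟩
        0# + Z                                           ≈⟨ +-identityˡ Z ⟩
        Z                                                ≈⟨ sum-const N w ⟩
        fromℕ N * w                                      ∎
        where
        open SetoidReasoning ℝ-setoid using (begin_; step-≈-⟩; step-≈-⟨; _∎)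
        U = sum (λ l → u i (r l))
        Z = sum {N} (λ _ → w)
        difference : ∀ u z → (1# * u + - 1# * z) + z ≈ u
        difference = solve 2 (λ u z → (:1 :* u :+ :- :1 :* z) :+ z := u) refl
        pointwise : ∀ l → 1# * u i (r l) + - 1# * w ≈ ⟦ g i ⟧ (r l)
        pointwise l = solve 2 (λ u w → :1 :* u :+ :- :1 :* w := u :- w) refl (u i (r l)) w
        N>0 : 0# < fromℕ N
        N>0 = <-≤-trans (0<fromℕ 0) (fromℕ-mono 1≤N)
        sum≈0 : sum {N} (λ l → ⟦ g i ⟧ (r l)) ≈ 0#
        -- Cancels the factor 1/N of the design average, nonzero because N is at least 1.
        sum≈0 = *-cancelˡ (<⇒≉ (0<x⇒0<x⁻¹ N>0)) (trans
          (isIntegral-unique (g i) (design (g i) (isComb-g i)))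
          (trans (expectation-g i) (sym (zeroʳ _))))

      -- Otherwise coordinate `i` would be a bit at every design point, and its sum N w would be an
      -- integer.
      moving : ∀ i → ∃[ l ] direction (r l) ≡ i
      moving i = decidable-stable (Fin.any? (λ l → direction (r l) Fin.≟ i)) λ none →
        let bits  = λ l → off-direction (r l) i (λ eq → none (l , eq))
            k , eq = sum-bits (λ l → proj₁ (bits l))
        in  Nw-nonintegral k (trans (sym (design-sum i)) (trans (sum-cong-≋ {N} (λ l → proj₂ (bits l))) eq))

      -- A 0-1 matrix for double counting: rows are design points, columns are the directions other
      -- than `zero`.
      count : Fin N → Fin n → Carrier
      count l i = unit (direction (r l)) (suc i)

      0≤count : ∀ l i → 0# ≤ count l i
      0≤count l i = 0≤bit (does (suc i Fin.≟ direction (r l)))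

      -- A point has a single direction, so its row sums to 0 or 1. The sum is 1 only for a
      -- direction other than `zero`, and there the height is 1.
      count≤height : ∀ l → sum (count l) ≤ u zero (r l)
      count≤height l = by-direction (direction (r l)) ≡.refl
        where
        0≢suc : ∀ {i : Fin n} → zero ≢ suc i
        0≢suc ()
        by-direction : ∀ d → direction (r l) ≡ d → sum (count l) ≤ u zero (r l)
        by-direction zero    d≡0 = ≤-respˡ-≈
          (sym (sum-0 {f = count l} λ i → unit-≢ (λ eq → 0≢suc (≡.trans (≡.sym d≡0) (≡.sym eq)))))
          (0≤u zero (r l))
        by-direction (suc d) d≡ = ≤-reflexive (trans
          (sum-single {f = count l} d (λ j j≢d → unit-≢ (λ eq → j≢d (Fin.suc-injective (≡.trans eq d≡)))))
          (trans (trans (reflexive (≡.cong (λ e → unit e (suc d)) d≡)) (unit-≡ (suc d)))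
            (sym (height-1 (r l) (λ d≡0 → 0≢suc (≡.trans (≡.sym d≡0) d≡))))))

      -- Double counting: each of the `n` columns sums to at least 1 by `moving`, each row to at
      -- most the height of its point, and the heights sum to N w.
      design-large : fromℕ n ≤ fromℕ N * w
      design-large = ≤-respʳ-≈ (design-sum zero)
        (≤-trans
          (≤-respˡ-≈ (trans (sum-const n 1#) (*-identityʳ _))
            (≤-respʳ-≈ (∑-comm (λ i l → count l i)) (sum-mono {n} each)))
          (sum-mono {N} count≤height))
        where
        each : ∀ i → 1# ≤ sum (λ l → count l i)
        each i = let l , eq = moving (suc i) in
          ≤-respˡ-≈ (trans (reflexive (≡.cong (λ e → unit e (suc i)) eq)) (unit-≡ (suc i)))
            (≤-sum (λ l → 0≤count l i) l)

    no-small-design : ∀ N → (∀ k → ¬ fromℕ N * w ≈ fromℕ k) → fromℕ N * w ≤ fromℕ n →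
                      ¬ HasDesignOfSize D N
    no-small-design N nonintegral Nw≤n (1≤N , r , design) =
      -- The two bounds leave only equality, which would make N w the integer `n`.
      nonintegral n (antisym Nw≤n (design-large r design 1≤N nonintegral))

-- Choice of the weight and verification of the bounds.

cube-problem : (em : ∀ {ℓ} → ExcludedMiddle ℓ) (ℝ : CompleteOrderedField) →
    let open Design ℝ in
    (n : ℕ) (k ε θ : Carrier) → 1# ≤ k → k + 1# < θ → θ < (k + 1#) + ε →
    (∀ j → j ℕ.< n → ∀ N → ¬ fromℕ (suc j) * θ ≈ fromℕ N) →
    Σ TopologicalDesignProblem λ D →
    let open TopologicalDesignProblem D in
    PathConnected X
    × HasDimension V (suc n)
    × (∃[ K ] (IsK D K × K ≤⁺ [ k + ε ]))
    × (∀ N → fromℕ N ≤ (fromℕ (suc n) - 1#) * (k + 1#) → ¬ HasDesignOfSize D N)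
cube-problem em ℝ n k ε θ 1≤k k+1<θ θ<k+1+ε no-multiple =
  D , Interpolation.ℝ-pathConnected ℝ , V-dimension , ([ κ ] , K≡κ , [ κ≤k+ε ]) ,
  λ N N≤ (1≤N , design) → no-small-design N (nonintegral N N≤ 1≤N) (Nw≤n N N≤) (1≤N , design)
  where
  open Design ℝ hiding (zero)
  open OrderedField ℝ
  open Construction em ℝ using (module Cube)

  0<k+1 : 0# < k + 1#
  0<k+1 = <-respʳ (+-comm 1# k) (0<+ 0<1 (≤-trans 0≤1 1≤k))

  0<θ : 0# < θ
  0<θ = <-≤-trans 0<k+1 (proj₁ k+1<θ)

  w = θ ⁻¹

  0<w : 0# < w
  0<w = 0<x⇒0<x⁻¹ 0<θ

  θ*w*x≈x : ∀ x → θ * (w * x) ≈ x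
  θ*w*x≈x x = trans (sym (*-assoc _ _ _)) (trans (*-congʳ (⁻¹-inverse (<⇒≉ 0<θ))) (*-identityˡ x))

  -- From k ≥ 1 follows θ > k + 1 ≥ 2.
  2w≤1 : w + w ≤ 1#
  2w≤1 = *-cancelˡ-≤ 0<θ (≤-respˡ-≈
    (trans (sym (θ*w*x≈x (1# + 1#))) (solve 2 (λ t w → t :* (w :* (:1 :+ :1)) := t :* (w :+ w)) refl θ w))
    (≤-respʳ-≈ (sym (*-identityʳ θ)) (≤-trans (+-mono-≤ 1# 1≤k) (proj₁ k+1<θ))))

  open Cube n w 0<w 2w≤1

  -- Here `κ` is θ - 1, and θ is below k + 1 + ε; the comparison is made after multiplication by
  -- `w`.
  κ≤k+ε : κ ≤ k + ε
  κ≤k+ε = *-cancelˡ-≤ 0<w (≤-respˡ-≈ (sym (trans (*-comm w κ) κ*w≈1-w))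
    (≤-diff (*-nonneg (proj₁ 0<w) (0≤y-x (proj₁ θ<k+1+ε)))
      (sym (trans
        (solve 4 (λ k e t w → (:1 :- w) :+ w :* (((k :+ :1) :+ e) :- t)
                              := (w :* (k :+ e)) :+ (:1 :- t :* w)) refl k ε θ w)
        (trans (+-congˡ (trans (+-congˡ (-‿cong (⁻¹-inverse (<⇒≉ 0<θ)))) (-‿inverseʳ 1#)))
          (+-identityʳ _))))))

  module _ (N : ℕ) (N≤ : fromℕ N ≤ (fromℕ (suc n) - 1#) * (k + 1#)) where
    Nw : Carrier
    Nw = fromℕ N * w

    θNw≈N : θ * Nw ≈ fromℕ N
    θNw≈N = trans (*-congˡ (*-comm _ _)) (θ*w*x≈x (fromℕ N))

    -- N is at most n (k + 1), hence at most n θ.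
    Nw≤n : Nw ≤ fromℕ n
    Nw≤n = *-cancelˡ-≤ 0<θ (≤-respˡ-≈ (sym θNw≈N) (≤-trans N≤
      (≤-respˡ-≈ (solve 2 (λ n k → n :* (k :+ :1) := ((:1 :+ n) :- :1) :* (k :+ :1)) refl (fromℕ n) k)
        (≤-respʳ-≈ (*-comm _ _) (*-monoˡ-≤ (0≤fromℕ n) (proj₁ k+1<θ))))))

    0<Nw : 1 ℕ.≤ N → 0# < Nw
    0<Nw 1≤N = 0<* (<-≤-trans (0<fromℕ 0) (fromℕ-mono 1≤N)) 0<w

    -- The value 0 is excluded because N w is positive, the values 1 to `n` by the choice of `θ`,
    -- and larger ones because N w is at most `n`.
    nonintegral : 1 ℕ.≤ N → ∀ j → ¬ Nw ≈ fromℕ j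
    nonintegral 1≤N zero    Nw≈0 = <⇒≉ (0<Nw 1≤N) Nw≈0
    nonintegral 1≤N (suc j) Nw≈j with ℕ.<-≤-connex j n
    ... | inj₁ j<n = no-multiple j j<n N (trans (*-comm _ _) (trans (*-congˡ (sym Nw≈j)) θNw≈N))
    ... | inj₂ n≤j = ≤⇒¬> Nw≤n (<-respʳ (sym Nw≈j)
      (≤-<-trans (fromℕ-mono n≤j) (<-diff 0<1 (fromℕ-suc j))))

proposition9 : (∀ {ℓ} → ExcludedMiddle ℓ) →
    (ℝ : CompleteOrderedField) →
    let open Design ℝ in
    (m : ℕ) → 1 ℕ.< m →
    (k ε : Carrier) → 1# ≤ k → 0# < ε →
    Σ TopologicalDesignProblem λ D →
    let open TopologicalDesignProblem D in
    PathConnected X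
    × HasDimension V m
    × (∃[ K ] (IsK D K × K ≤⁺ [ k + ε ]))
    × (∀ N → fromℕ N ≤ (fromℕ m - 1#) * (k + 1#) → ¬ HasDesignOfSize D N)
proposition9 em ℝ (suc n) 1<m k ε 1≤k 0<ε =
  -- `θ` is taken strictly between k + 1 and k + 1 + ε so that none of θ, 2θ, ..., nθ is a natural
  -- number.
  let θ , k+1<θ , θ<k+1+ε , no-multiple = Generic.generic em ℝ n (OrderedField.<-diff ℝ 0<ε refl)
  in  cube-problem em ℝ n k ε θ 1≤k k+1<θ θ<k+1+ε no-multiple
  where open CompleteOrderedField ℝ
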